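{- Let $n\ge 3$ and let $G$ and $H$ be graphs on $n$ vertices such that $G$ is bipartite and $H$ is not bipartite. Then $G$ and $H$ have fewer than $\frac{5n}{6}+2$ common cards. (Equivalently: whether a graph on $n$ vertices is bipartite can be determined from any $\frac{5n}{6}+2$ of its cards.)
   Context: All graphs are finite and simple. For a graph $X$ and a vertex $v$, the card $X-v$ is the unlabeled graph obtained by deleting $v$ and its incident edges; the deck of $X$ is the multiset $\{X-v : v\in V(X)\}$. The number of common cards of two graphs $X,Y$ on the same number of vertices is the size of the multiset intersection of their decks, i.e. the largest $m$ such that there are distinct vertices $x_1,\dots,x_m$ of $X$ and distinct vertices $y_1,\dots,y_m$ of $Y$ with $X-x_i\cong Y-y_i$ for all $i$. -}

module Defs where

open import Data.Nat using (ℕ; suc)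
open import Data.Bool using (Bool; true; false)
open import Data.Fin using (Fin; punchIn)
open import Data.Product using (Σ; ∃; _×_)
open import Function.Bundles using (Bijection; _⤖_)
open import Function.Definitions using (Injective)
open import Relation.Binary.PropositionalEquality using (_≡_)
open import Relation.Nullary using (¬_)

record Graph (n : ℕ) : Set where
  field
    adj    : Fin n → Fin n → Bool
    sym    : ∀ u v → adj u v ≡ adj v u
    irrefl : ∀ v → adj v v ≡ false
open Graph public

_≅_ : {n : ℕ} → Graph n → Graph n → Set
_≅_ {n} G H = Σ (Fin n ⤖ Fin n) λ σ →
  ∀ u v → adj G u v ≡ adj H (Bijection.to σ u) (Bijection.to σ v)

card : {n : ℕ} → Graph (suc n) → Fin (suc n) → Graph n
card G v = record
  { adj    = λ i j → adj G (punchIn v i) (punchIn v j)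
  ; sym    = λ i j → sym G (punchIn v i) (punchIn v j)
  ; irrefl = λ i → irrefl G (punchIn v i)
  }

HasCommonCards : {n : ℕ} → Graph (suc n) → Graph (suc n) → ℕ → Set
HasCommonCards {n} G H m =
  Σ (Fin m → Fin (suc n)) λ x → Σ (Fin m → Fin (suc n)) λ y →
    Injective _≡_ _≡_ x × Injective _≡_ _≡_ y × (∀ i → card G (x i) ≅ card H (y i))

Bipartite : {n : ℕ} → Graph n → Set
Bipartite {n} G = ∃ λ (c : Fin n → Bool) → ∀ u v → adj G u v ≡ true → ¬ (c u ≡ c v)

{-# OPTIONS --safe #-}
module Submission where

-- Suppose m ≥ 5n/6 + 2. Deleting any matched vertex of H leaves a bipartite graph, so a
-- shortest odd cycle C of H, of length ℓ, contains all m of them, and ρ = n − ℓ ≤ μ = n − m.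
-- Deleting a matched vertex of H thus leaves two vertices at distance exactly L = ℓ − 2, and by
-- means of trees hanging off C one sees that at most 3ρ such deletions create a finite distance
-- above L. Both facts pass to the matched vertices of G.
--
-- In G, some matched x has at most two neighbours: almost all vertices of a geodesic
-- u 0, …, u L of G − x₀, with x₀ matched, are alone in their distance layer. Now let u be such a geodesic of
-- G − x. For matched u i alone in their layers, G − u i still has a geodesic of length L, which
-- forces x to join the two sides of u i; so x has one neighbour z₁ near u 0 and one neighbour
-- z₂ near u L. Their distance d in G − x is even, as G is bipartite, whereas L is odd.
-- If d > L, then deleting the matched cut vertices between z₁ and z₂ creates distances above L
-- too often. If d < L, the cycle through x, z₁, z₂ is too short: the geodesics of length L in
-- the graphs G − u i have to end in the parts of G − x beyond z₁ or z₂, which is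
-- possible for few i only, and counting the indices i ≤ L gives L + 1 ≤ 4ρ + μ + 4 < L + 1.

open import Defs
open import Data.Bool using (Bool; true; false; not; _xor_)
import Data.Bool.Properties as Bool
open import Data.Empty using (⊥; ⊥-elim)
open import Data.Fin as Fin using (Fin; fromℕ<; toℕ; punchIn; punchOut)
import Data.Fin.Properties as F
open import Data.List using (List; []; _∷_; _++_; length; lookup; map; filter; tabulate; applyUpTo; upTo; allFin)
open import Data.List.Properties using (length-++; length-applyUpTo; length-map; length-tabulate)
open import Data.List.Membership.Propositional using (_∈_; _∉_)
import Data.List.Membership.Propositional.Properties as ∈P
open import Data.List.Relation.Unary.All as All using (All)
import Data.List.Relation.Unary.All.Properties as AllP
import Data.List.Relation.Unary.AllPairs as AllPairs
open import Data.List.Relation.Unary.Any as Any using (here; there)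
import Data.List.Relation.Unary.Any.Properties as AnyP
open import Data.List.Relation.Unary.Unique.Propositional using (Unique)
import Data.List.Relation.Unary.Unique.Propositional.Properties as UniqueP
open import Data.Nat hiding (parity)
open import Data.Nat.DivMod using (_%_; _/_; m%n<n; m<n⇒m%n≡m; n%n≡0; [m+n]%n≡m%n; [m+kn]%n≡m%n; m≡m%n+[m/n]*n)
open import Data.Nat.Properties
open import Data.Nat.Tactic.RingSolver using (solve; solve-∀)
open import Data.Product using (Σ; ∃; _×_; _,_; proj₁; proj₂)
open import Data.Sum using (_⊎_; inj₁; inj₂)
open import Data.Unit using (⊤; tt)
open import Function using (_∘_)
open import Function.Bundles using (Bijection)
open import Relation.Binary.Definitions using (tri<; tri≈; tri>)
open import Relation.Binary.PropositionalEquality renaming (sym to ≡-sym)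
open import Relation.Nullary
open import Relation.Nullary.Decidable using (_×-dec_; ¬?; decidable-stable)
open import Relation.Unary using (Decidable)

-- Counting

-- An instance of linear arithmetic, the equation being an identity for the ring solver.
linear : ∀ {A B a b} c → A ≤ B → A + b ≡ B + a + c → a ≤ b
linear {A} {B} {a} {b} c A≤B e = +-cancelˡ-≤ B a b (begin
  B + a      ≤⟨ m≤m+n (B + a) c ⟩
  B + a + c  ≡⟨ e ⟨
  A + b      ≤⟨ +-monoˡ-≤ b A≤B ⟩
  B + b      ∎)
  where open ≤-Reasoning

_⊕_ : ∀ {a b c d} → a ≤ b → c ≤ d → a + c ≤ b + d
_⊕_ = +-mono-≤
infixr 5 _⊕_

_⊙_ : ∀ k {a b} → a ≤ b → k * a ≤ k * b
k ⊙ p = *-monoʳ-≤ k p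
infixr 6 _⊙_

-- Duplicate-free lists serve as finite subsets: the predicate may be undecidable and `A` infinite,
-- and upper bounds add up in `atMost-⊎` without any disjointness.
AtMost : {A : Set} → ℕ → (A → Set) → Set
AtMost k P = ∀ xs → Unique xs → All P xs → length xs ≤ k

atMost-≤ : ∀ {A : Set} {P : A → Set} {k l} → k ≤ l → AtMost k P → AtMost l P
atMost-≤ k≤l h xs u ps = ≤-trans (h xs u ps) k≤l

atMost-⊆ : ∀ {A : Set} {P Q : A → Set} {k} → (∀ a → P a → Q a) → AtMost k Q → AtMost k P
atMost-⊆ sub h xs u ps = h xs u (All.map (sub _) ps)

atMost-≡ : ∀ {A : Set} → (b : A) → AtMost 1 (λ a → a ≡ b)
atMost-≡ b []           u ps = z≤n
atMost-≡ b (x ∷ [])     u ps = ≤-refl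
atMost-≡ b (x ∷ y ∷ xs) ((x≢y All.∷ _) AllPairs.∷ _) (p All.∷ q All.∷ _) = ⊥-elim (x≢y (trans p (≡-sym q)))

private
  partition : ∀ {A : Set} {P Q : A → Set} → ∀ (xs : List A) → Unique xs → All (λ a → P a ⊎ Q a) xs →
    Σ (List A) λ ys → Σ (List A) λ zs → Unique ys × Unique zs × All P ys × All Q zs ×
      (∀ {R : A → Set} → All R xs → All R ys × All R zs) × length xs ≡ length ys + length zs
  partition [] u All.[] = [] , [] , AllPairs.[] , AllPairs.[] , All.[] , All.[] , (λ _ → All.[] , All.[]) , refl
  partition (x ∷ xs) (x∉ AllPairs.∷ u) (p All.∷ ps) with partition xs u ps | p
  ... | ys , zs , uy , uz , py , qz , sub , e | inj₁ px =
    x ∷ ys , zs , proj₁ (sub x∉) AllPairs.∷ uy , uz , px All.∷ py , qz ,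
    (λ { (r All.∷ rs) → r All.∷ proj₁ (sub rs) , proj₂ (sub rs) }) , cong suc e
  ... | ys , zs , uy , uz , py , qz , sub , e | inj₂ qx =
    ys , x ∷ zs , uy , proj₂ (sub x∉) AllPairs.∷ uz , py , qx All.∷ qz ,
    (λ { (r All.∷ rs) → proj₁ (sub rs) , r All.∷ proj₂ (sub rs) }) ,
    trans (cong suc e) (≡-sym (+-suc (length ys) (length zs)))

atMost-⊎ : ∀ {A : Set} {P Q : A → Set} {k l} → AtMost k P → AtMost l Q → AtMost (k + l) (λ a → P a ⊎ Q a)
atMost-⊎ hP hQ xs u ps with partition xs u ps
... | ys , zs , uy , uz , py , qz , _ , e = ≤-trans (≤-reflexive e) (hP ys uy py ⊕ hQ zs uz qz)

-- The assignment is a relation, so that the witness b may depend on the proof of `P a`. Since b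
-- determines a, distinct elements receive distinct witnesses.
atMost-image : ∀ {A B : Set} {P : A → Set} {Q : B → Set} {k} → (R : A → B → Set) → (∀ {a a′ b} → R a b → R a′ b → a ≡ a′) →
  (∀ a → P a → Σ B λ b → Q b × R a b) → AtMost k Q → AtMost k P
atMost-image {A = A} {B = B} {P = P} {Q = Q} R inv f h xs u ps with go xs u ps
  where
  go : ∀ xs → Unique xs → All P xs → Σ (List B) λ ys → Unique ys × All Q ys ×
    All (λ b → Σ A λ a → a ∈ xs × R a b) ys × length xs ≡ length ys
  go [] u ps = [] , AllPairs.[] , All.[] , All.[] , refl
  go (x ∷ xs) (x∉ AllPairs.∷ u) (p All.∷ ps) with go xs u ps | f x p
  ... | ys , uy , qy , src , e | y , q , r =
    y ∷ ys ,
    All.map (λ { (a , a∈ , ra) y≡ → All.lookup x∉ a∈ (inv (subst (R x) y≡ r) ra) }) src AllPairs.∷ uy ,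
    q All.∷ qy ,
    (x , here refl , r) All.∷ All.map (λ { (a , a∈ , ra) → a , there a∈ , ra }) src ,
    cong suc e
... | ys , uy , qy , _ , e = ≤-trans (≤-reflexive e) (h ys uy qy)

-- A duplicate-free list avoiding `ys` stays duplicate-free when `ys` is appended, and the bound for
-- the whole type applies to the result.
atMost-complement : ∀ {A : Set} {k n o} (ys : List A) → AtMost n (λ (_ : A) → ⊤) → Unique ys →
  length ys ≡ o → k + o ≡ n → AtMost k (λ a → a ∉ ys)
atMost-complement {k = k} {o = o} ys h uy refl refl xs ux x∉ =
  +-cancelʳ-≤ o (length xs) k
    (≤-trans (≤-reflexive (≡-sym (length-++ xs)))
      (h (xs ++ ys) (UniqueP.++⁺ ux uy (λ { (x∈ , y∈) → All.lookup x∉ x∈ y∈ })) (All.tabulate (λ _ → tt))))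

unique-lookup-injective : ∀ {A : Set} {xs : List A} → Unique xs → ∀ {i j} → lookup xs i ≡ lookup xs j → i ≡ j
unique-lookup-injective {xs = x ∷ xs} u {Fin.zero} {Fin.zero} e = refl
unique-lookup-injective {xs = x ∷ xs} (x∉ AllPairs.∷ u) {Fin.zero} {Fin.suc j} e = ⊥-elim (All.lookup x∉ (∈P.∈-lookup j) e)
unique-lookup-injective {xs = x ∷ xs} (x∉ AllPairs.∷ u) {Fin.suc i} {Fin.zero} e = ⊥-elim (All.lookup x∉ (∈P.∈-lookup i) (≡-sym e))
unique-lookup-injective {xs = x ∷ xs} (x∉ AllPairs.∷ u) {Fin.suc i} {Fin.suc j} e = cong Fin.suc (unique-lookup-injective u e)

atMost-Fin : ∀ {n} {P : Fin n → Set} → AtMost {Fin n} n P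
atMost-Fin xs u _ = F.injective⇒≤ (unique-lookup-injective u)

atMost-avoid : ∀ {n o k} (g : ℕ → Fin n) → (∀ {i j} → i < o → j < o → g i ≡ g j → i ≡ j) → k + o ≡ n →
  AtMost k (λ v → ∀ i → i < o → v ≢ g i)
atMost-avoid {n} {o} g inj e = atMost-⊆ avoid
  (atMost-complement (applyUpTo g o) atMost-Fin
    (UniqueP.applyUpTo⁺₁ g o (λ i<j j<o gi≡gj → <⇒≢ i<j (inj (<-trans i<j j<o) j<o gi≡gj)))
    (length-applyUpTo g o) e)
  where
  avoid : ∀ v → (∀ i → i < o → v ≢ g i) → v ∉ applyUpTo g o
  avoid v h v∈ with ∈P.∈-applyUpTo⁻ g v∈
  ... | i , i<o , v≡ = h i i<o v≡

atMost-avoid-Fin : ∀ {n o k} (g : Fin o → Fin n) → (∀ {i j} → g i ≡ g j → i ≡ j) → k + o ≡ n →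
  AtMost k (λ v → ∀ i → v ≢ g i)
atMost-avoid-Fin {n} {o} g inj e = atMost-⊆ avoid
  (atMost-complement (tabulate g) atMost-Fin (UniqueP.tabulate⁺ inj) (length-tabulate g) e)
  where
  avoid : ∀ v → (∀ i → v ≢ g i) → v ∉ tabulate g
  avoid v h v∈ with ∈P.∈-tabulate⁻ v∈
  ... | i , v≡ = h i v≡

atMost-injective : ∀ {n o k} {P : Fin n → Set} (g : ℕ → Fin n) → (∀ {i j} → i < o → j < o → g i ≡ g j → i ≡ j) →
  AtMost k P → (∀ i → i < o → P (g i)) → o ≤ k
atMost-injective {o = o} g inj h p = ≤-trans (≤-reflexive (≡-sym (length-applyUpTo g o)))
  (h (applyUpTo g o) (UniqueP.applyUpTo⁺₁ g o (λ i<j j<o e → <⇒≢ i<j (inj (<-trans i<j j<o) j<o e)))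
     (AllP.applyUpTo⁺₁ g o (p _)))

atMost-upTo : ∀ {N k} {P : ℕ → Set} → AtMost k P → (∀ i → i < N → P i) → N ≤ k
atMost-upTo {N = N} h p = ≤-trans (≤-reflexive (≡-sym (length-applyUpTo (λ i → i) N)))
  (h (upTo N) (UniqueP.upTo⁺ N) (AllP.applyUpTo⁺₁ (λ i → i) N (p _)))

atMost-range : ∀ s t → AtMost (t ∸ s) (λ i → s ≤ i × i < t)
atMost-range s t xs u ps = ≤-trans (≤-reflexive (≡-sym (length-map (_∸ s) xs)))
  (bound (map (_∸ s) xs) (um xs u ps) (AllP.map⁺ (All.map (λ { (s≤ , <t) → ∸-monoˡ-< <t s≤ }) ps)))
  where
  um : ∀ xs → Unique xs → All (λ i → s ≤ i × i < t) xs → Unique (map (_∸ s) xs)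
  um [] u ps = AllPairs.[]
  um (x ∷ xs) (x∉ AllPairs.∷ u) (p All.∷ ps) =
    AllP.map⁺ (All.tabulate λ {y} y∈ e → All.lookup x∉ y∈ (∸-cancelʳ-≡ (proj₁ p) (proj₁ (All.lookup ps y∈)) e))
    AllPairs.∷ um xs u ps
  bound : ∀ {N} ys → Unique ys → All (_< N) ys → length ys ≤ N
  bound {N} ys = atMost-image {A = ℕ} {B = Fin N} {P = _< N} {Q = λ _ → ⊤} (λ a b → a ≡ toℕ b)
    (λ p q → trans p (≡-sym q)) (λ a a<N → fromℕ< a<N , tt , ≡-sym (F.toℕ-fromℕ< a<N)) atMost-Fin ys

unique-⊆-length : ∀ {A : Set} (xs ys : List A) → Unique xs → (∀ {a} → a ∈ xs → a ∈ ys) → length xs ≤ length ys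
unique-⊆-length xs ys u sub = atMost-image {P = _∈ xs} {Q = λ (_ : Fin (length ys)) → ⊤}
  (λ a i → a ≡ lookup ys i) (λ p q → trans p (≡-sym q))
  (λ a a∈ → Any.index (sub a∈) , tt , AnyP.lookup-index (sub a∈)) atMost-Fin xs u (All.tabulate λ a∈ → a∈)

-- Exact cardinalities are needed where a count stands on the smaller side of an inequality, as for
-- the three classes of extra vertices whose sizes sum to at most ρ.
record Card {n} (P : Fin n → Set) (k : ℕ) : Set where
  field
    elems  : List (Fin n)
    unique : Unique elems
    all    : All P elems
    size   : length elems ≡ k
    atMost : AtMost k P
open Card public

abstract
  card-of : ∀ {n} {P : Fin n → Set} → Decidable P → ∃ (Card P)
  card-of {n} P? = _ , record
    { elems  = filter P? (allFin n)
    ; unique = UniqueP.filter⁺ P? (UniqueP.allFin⁺ n)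
    ; all    = AllP.all-filter P? (allFin n)
    ; size   = refl
    ; atMost = λ xs u ps → unique-⊆-length xs _ u (λ a∈ → ∈P.∈-filter⁺ P? (∈P.∈-allFin _) (All.lookup ps a∈)) }

card-⊎ : ∀ {n a b} {P Q : Fin n → Set} → Card P a → Card Q b → (∀ v → P v → ¬ Q v) →
  Card (λ v → P v ⊎ Q v) (a + b)
card-⊎ {P = P} {Q} cP cQ disj = record
  { elems  = elems cP ++ elems cQ
  ; unique = UniqueP.++⁺ (unique cP) (unique cQ)
      (λ { (p , q) → disj _ (All.lookup (all cP) p) (All.lookup (all cQ) q) })
  ; all    = AllP.++⁺ (All.map inj₁ (all cP)) (All.map inj₂ (all cQ))
  ; size   = trans (length-++ (elems cP)) (cong₂ _+_ (size cP) (size cQ))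
  ; atMost = atMost-⊎ (atMost cP) (atMost cQ) }

card-≤ : ∀ {n a b} {P Q : Fin n → Set} → Card P a → (∀ v → P v → Q v) → AtMost b Q → a ≤ b
card-≤ cP sub h = ≤-trans (≤-reflexive (≡-sym (size cP))) (h (elems cP) (unique cP) (All.map (sub _) (all cP)))

-- Walks and distances

search : {P : ℕ → Set} → Decidable P → ∀ N →
  (Σ ℕ λ k → k < N × P k × (∀ j → j < k → ¬ P j)) ⊎ (∀ j → j < N → ¬ P j)
search P? zero = inj₂ λ j ()
search P? (suc N) with search P? N
... | inj₁ (k , k<N , p , min) = inj₁ (k , m<n⇒m<1+n k<N , p , min)
... | inj₂ none with P? N
...   | yes p = inj₁ (N , ≤-refl , p , none)
...   | no ¬p = inj₂ λ j j<1+N pj → case-≤ (m≤n⇒m<n∨m≡n (s≤s⁻¹ j<1+N)) pj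
  where
  case-≤ : ∀ {j} → j < N ⊎ j ≡ N → _ → ⊥
  case-≤ (inj₁ j<N)  pj = none _ j<N pj
  case-≤ (inj₂ refl) pj = ¬p pj

least : {P : ℕ → Set} → Decidable P → ∀ {k} → P k → Σ ℕ λ d → P d × d ≤ k × (∀ j → P j → d ≤ j)
least P? {k} p with search P? (suc k)
... | inj₁ (d , d<1+k , pd , min) = d , pd , s≤s⁻¹ d<1+k , λ j pj → ≮⇒≥ λ j<d → min j j<d pj
... | inj₂ none = ⊥-elim (none k ≤-refl p)

parity : ℕ → Bool
parity zero    = false
parity (suc k) = not (parity k)

Adj : ∀ {n} → Graph n → Fin n → Fin n → Set
Adj G u v = adj G u v ≡ true

module _ {n : ℕ} (G : Graph n) where

  adj? : ∀ u v → Dec (Adj G u v)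
  adj? u v = adj G u v Bool.≟ true

  adj-sym : ∀ {u v} → Adj G u v → Adj G v u
  adj-sym {u} {v} = trans (sym G v u)

  adj-irrefl : ∀ {v} → ¬ Adj G v v
  adj-irrefl {v} e with trans (≡-sym e) (irrefl G v)
  ... | ()

  -- Deleting x means taking `S` to be `_≢ x`. Vertices of G - x keep their names, so walks in
  -- different vertex-deleted subgraphs can be combined directly.
  data Walk (S : Fin n → Set) : Fin n → Fin n → ℕ → Set where
    nil  : ∀ {u} → S u → Walk S u u 0
    cons : ∀ {u v w k} → S u → Adj G u v → Walk S v w k → Walk S u w (suc k)

  -- Being a relation, it asserts connectedness too: vertices in different components have no
  -- `Dist`.
  Dist : (Fin n → Set) → Fin n → Fin n → ℕ → Set
  Dist S u v d = Walk S u v d × (∀ k → Walk S u v k → d ≤ k)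

module _ {n : ℕ} {G : Graph n} where
  private variable
    S T : Fin n → Set
    u v w : Fin n
    k l d : ℕ

  walk-⊆ : (∀ v → S v → T v) → Walk G S u v k → Walk G T u v k
  walk-⊆ f (nil s)      = nil (f _ s)
  walk-⊆ f (cons s e p) = cons (f _ s) e (walk-⊆ f p)

  walk-start : Walk G S u v k → S u
  walk-start (nil s)      = s
  walk-start (cons s _ _) = s

  walk-end : Walk G S u v k → S v
  walk-end (nil s)      = s
  walk-end (cons _ _ p) = walk-end p

  walk-++ : Walk G S u v k → Walk G S v w l → Walk G S u w (k + l)
  walk-++ (nil s)      q = q
  walk-++ (cons s e p) q = cons s e (walk-++ p q)

  walk-snoc : Walk G S u v k → Adj G v w → S w → Walk G S u w (suc k)
  walk-snoc (nil s)      e t = cons s e (nil t)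
  walk-snoc (cons s f p) e t = cons s f (walk-snoc p e t)

  walk-rev : Walk G S u v k → Walk G S v u k
  walk-rev (nil s)      = nil s
  walk-rev (cons s e p) = walk-snoc (walk-rev p) (adj-sym G e) s

  at : Walk G S u v k → ℕ → Fin n
  at {u = u} p            zero    = u
  -- Past its last vertex a walk stands still.
  at {u = u} (nil _)      (suc i) = u
  at         (cons _ _ p) (suc i) = at p i

  at-end : (p : Walk G S u v k) → at p k ≡ v
  at-end (nil _)      = refl
  at-end (cons _ _ p) = at-end p

  at-prefix : (p : Walk G S u v k) → ∀ i → i ≤ k → Walk G S u (at p i) i
  at-prefix p            zero    _   = nil (walk-start p)
  at-prefix (cons s e p) (suc i) i≤k = cons s e (at-prefix p i (s≤s⁻¹ i≤k))

  at-suffix : (p : Walk G S u v k) → ∀ i → i ≤ k → Walk G S (at p i) v (k ∸ i)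
  at-suffix p            zero    _   = p
  at-suffix (cons s e p) (suc i) i≤k = at-suffix p i (s≤s⁻¹ i≤k)

  at-∈ : (p : Walk G S u v k) → ∀ i → i ≤ k → S (at p i)
  at-∈ p i i≤k = walk-end (at-prefix p i i≤k)

  at-adj : (p : Walk G S u v k) → ∀ i → i < k → Adj G (at p i) (at p (suc i))
  at-adj (cons s e p) zero    _   = e
  at-adj (cons s e p) (suc i) i<k = at-adj p i (s≤s⁻¹ i<k)

  walk-on : (p : Walk G S u v k) → ∀ i → i ≤ k → (∀ j → j ≤ i → T (at p j)) → Walk G T u (at p i) i
  walk-on p            zero    _   t = nil (t 0 z≤n)
  walk-on (cons s e p) (suc i) i≤k t = cons (t 0 z≤n) e (walk-on p i (s≤s⁻¹ i≤k) (λ j j≤i → t (suc j) (s≤s j≤i)))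

  walk-from : (p : Walk G S u v k) → ∀ i → i ≤ k → (∀ j → i ≤ j → j ≤ k → T (at p j)) → Walk G T (at p i) v (k ∸ i)
  walk-from (nil s)      zero    _   t = nil (t 0 z≤n z≤n)
  walk-from (cons s e p) zero    _   t = cons (t 0 z≤n z≤n) e (walk-from p 0 z≤n (λ j _ j≤k → t (suc j) z≤n (s≤s j≤k)))
  walk-from (cons s e p) (suc i) i≤k t = walk-from p i (s≤s⁻¹ i≤k) (λ j i≤j j≤k → t (suc j) (s≤s i≤j) (s≤s j≤k))

  walk? : Decidable S → ∀ u v k → Dec (Walk G S u v k)
  walk? S? u v zero with u F.≟ v
  ... | no u≢v = no λ { (nil _) → u≢v refl }
  ... | yes refl with S? u
  ...   | yes s = yes (nil s)
  ...   | no ¬s = no λ { (nil s) → ¬s s }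
  walk? S? u v (suc k) with S? u ×-dec F.any? (λ w → adj? G u w ×-dec walk? S? w v k)
  ... | yes (s , w , e , p) = yes (cons s e p)
  ... | no none = no λ { (cons s e p) → none (s , _ , e , p) }

  abstract
    walk-dist : Decidable S → Walk G S u v k → Σ ℕ λ d → Dist G S u v d × d ≤ k
    walk-dist S? p with least (walk? S? _ _) p
    ... | d , q , d≤k , min = d , (q , min) , d≤k

  dist-sym : Dist G S u v d → Dist G S v u d
  dist-sym (p , min) = walk-rev p , λ k q → min k (walk-rev q)

  dist-unique : Dist G S u v k → Dist G S u v l → k ≡ l
  dist-unique (p , minp) (q , minq) = ≤-antisym (minp _ q) (minq _ p)

  -- A shortcut to an inner vertex of a geodesic, continued along the geodesic, would be a shortcut
  -- to its end.
  dist-prefix : (D : Dist G S u v d) → ∀ i → i ≤ d → Dist G S u (at (proj₁ D) i) i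
  dist-prefix {d = d} (p , min) i i≤d = at-prefix p i i≤d , λ k q →
    +-cancelʳ-≤ (d ∸ i) i k (≤-trans (≤-reflexive (m+[n∸m]≡n i≤d))
      (min _ (walk-++ q (at-suffix p i i≤d))))

  dist-injective : (D : Dist G S u v d) → ∀ {i j} → i < suc d → j < suc d →
    at (proj₁ D) i ≡ at (proj₁ D) j → i ≡ j
  dist-injective D {i} {j} i≤d j≤d e =
    dist-unique (subst (λ w → Dist G _ _ w i) e (dist-prefix D i (s≤s⁻¹ i≤d))) (dist-prefix D j (s≤s⁻¹ j≤d))

  dist-≤ : (D : Dist G S u v d) → AtMost k T → (∀ i → i ≤ d → T (at (proj₁ D) i)) → suc d ≤ k
  dist-≤ D h t = atMost-injective (at (proj₁ D)) (dist-injective D) h (λ i i≤d → t i (s≤s⁻¹ i≤d))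

  at-closed : (p : Walk G S u v k) → T u → (∀ {v w} → S v → S w → Adj G v w → T v → T w) →
    ∀ i → i ≤ k → T (at p i)
  at-closed p t cl zero _ = t
  at-closed (cons s e p) t cl (suc i) i≤k = at-closed p (cl s (walk-start p) e t) cl i (s≤s⁻¹ i≤k)

  abstract
    walk-bounded : Decidable S → AtMost l S → Walk G S u v k → Σ ℕ λ d → Walk G S u v d × suc d ≤ l
    walk-bounded S? h p with walk-dist S? p
    ... | d , D , _ = d , proj₁ D , dist-≤ D h (at-∈ (proj₁ D))

  walk-colour : (c : Fin n → Bool) → (∀ {v w} → S v → S w → Adj G v w → c v ≢ c w) →
    Walk G S u v k → c v ≡ parity k xor c u
  walk-colour c proper (nil s) = refl
  walk-colour {k = suc k} c proper (cons {u} {v} s e p) =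
    trans (walk-colour c proper p) (flip (parity k) (Bool.¬-not (proper (walk-start p) s (adj-sym G e))))
    where
    flip : ∀ b {x y} → x ≡ not y → b xor x ≡ not b xor y
    flip false {y = y} refl = refl
    flip true  {y = y} refl = Bool.not-involutive y

-- lev v is the distance from r to v inside S, cut off at N.
record Level {n} (G : Graph n) (S : Fin n → Set) (r : Fin n) (N : ℕ) : Set where
  field
    lev      : Fin n → ℕ
    lev-walk : ∀ v → lev v < N → Walk G S r v (lev v)
    lev-min  : ∀ {v k} → Walk G S r v k → lev v ≤ k
    lev-≤    : ∀ v → lev v ≤ N

  -- Cutting off preserves the Lipschitz property: when v has level N, no level of w can exceed it.
  lev-lip : ∀ {v w} → S w → Adj G v w → lev w ≤ suc (lev v)
  lev-lip {v} {w} s e with lev v <? N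
  ... | yes <N = lev-min (walk-snoc (lev-walk v <N) e s)
  ... | no  ≮N = ≤-trans (lev-≤ w) (m≤n⇒m≤1+n (≮⇒≥ ≮N))

level : ∀ {n} (G : Graph n) {S : Fin n → Set} → Decidable S → ∀ r N → Level G S r N
level {n} G {S} S? r N = record
  { lev      = λ v → lv (find v)
  ; lev-walk = λ v → lw (find v)
  ; lev-min  = λ {v} p → lm (find v) p
  ; lev-≤    = λ v → l≤ (find v) }
  where
  Found : Fin n → Set
  Found v = (Σ ℕ λ k → k < N × Walk G S r v k × (∀ j → j < k → ¬ Walk G S r v j))
            ⊎ (∀ j → j < N → ¬ Walk G S r v j)
  find : ∀ v → Found v
  find v = search (walk? S? r v) N
  lv : ∀ {v} → Found v → ℕ
  lv (inj₁ (k , _)) = k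
  lv (inj₂ _)       = N
  lw : ∀ {v} (x : Found v) → lv x < N → Walk G S r v (lv x)
  lw (inj₁ (_ , _ , p , _)) _   = p
  lw (inj₂ _)               N<N = ⊥-elim (<-irrefl refl N<N)
  lm : ∀ {v k} (x : Found v) → Walk G S r v k → lv x ≤ k
  lm (inj₁ (_ , _ , _ , min)) q = ≮⇒≥ λ lt → min _ lt q
  lm (inj₂ none)              q = ≮⇒≥ λ lt → none _ lt q
  l≤ : ∀ {v} (x : Found v) → lv x ≤ N
  l≤ (inj₁ (_ , k<N , _)) = <⇒≤ k<N
  l≤ (inj₂ _)             = ≤-refl

-- The shortest odd cycle

≢-dec : ∀ {n} (y : Fin n) → Decidable (_≢ y)
≢-dec y v = ¬? (v F.≟ y)

parity-+ : ∀ a b → parity (a + b) ≡ parity a xor parity b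
parity-+ zero    b = refl
parity-+ (suc a) b = trans (cong not (parity-+ a b)) (Bool.not-distribˡ-xor (parity a) (parity b))

odd-form : ∀ k → parity k ≡ true → Σ ℕ λ q → k ≡ suc (q + q)
odd-form (suc zero)    _ = 0 , refl
odd-form (suc (suc k)) e with odd-form k (trans (≡-sym (Bool.not-involutive (parity k))) e)
... | q , refl = suc q , cong (suc ∘ suc) (≡-sym (+-suc q q))

double-even : ∀ q → parity (q + q) ≡ false
double-even q = trans (parity-+ q q) (Bool.xor-same (parity q))

Everywhere : ∀ {n} → Fin n → Set
Everywhere _ = ⊤

Far : ∀ {n} → Graph n → Fin n → ℕ → Set
Far G x D = Σ _ λ u → Σ _ λ v → Σ ℕ λ d → Dist G (_≢ x) u v d × D ≤ d

ProperOff : ∀ {n} → Graph n → Fin n → (Fin n → Bool) → Set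
ProperOff G x c = ∀ {v w} → v ≢ x → w ≢ x → Adj G v w → c v ≢ c w

-- The cycle is given as an odd closed walk of minimal length ℓ = 2r + 3; `c-≢` derives from
-- minimality that it repeats no vertex. Indices of `c` are read modulo ℓ.
module ShortestOddCycle {n} (H : Graph n) (r : ℕ) {v₀ : Fin n}
  (W : Walk H Everywhere v₀ v₀ (suc (suc r + suc r)))
  (shortest : ∀ q v → Walk H Everywhere v v (suc (q + q)) → suc r ≤ q) where

  L ℓ : ℕ
  L = r + suc r
  ℓ = suc (suc L)

  c : ℕ → Fin n
  c i = at W (i % ℓ)

  c-adj : ∀ i → Adj H (c i) (c (suc i))
  c-adj i with suc (i % ℓ) <? ℓ
  ... | yes lt = subst (λ j → Adj H (c i) (at W j)) (≡-sym (trans next (m<n⇒m%n≡m lt))) (at-adj W (i % ℓ) (m%n<n i ℓ))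
    where
    next : suc i % ℓ ≡ suc (i % ℓ) % ℓ
    next = trans (cong (λ j → suc j % ℓ) (m≡m%n+[m/n]*n i ℓ)) ([m+kn]%n≡m%n (suc (i % ℓ)) (i / ℓ) ℓ)
  -- Here i is the last index modulo ℓ, and the step returns to the start of the closed walk.
  ... | no ≮ℓ = subst (Adj H (c i)) eq (at-adj W (i % ℓ) (m%n<n i ℓ))
    where
    last : suc (i % ℓ) ≡ ℓ
    last = ≤-antisym (m%n<n i ℓ) (≮⇒≥ ≮ℓ)
    next : suc i % ℓ ≡ 0
    next = trans (cong (λ j → suc j % ℓ) (m≡m%n+[m/n]*n i ℓ))
      (trans ([m+kn]%n≡m%n (suc (i % ℓ)) (i / ℓ) ℓ) (trans (cong (_% ℓ) last) (n%n≡0 ℓ)))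
    eq : at W (suc (i % ℓ)) ≡ c (suc i)
    eq = trans (cong (at W) last) (trans (at-end W) (cong (at W) (≡-sym next)))

  c-period : ∀ i → c (i + ℓ) ≡ c i
  c-period i = cong (at W) ([m+n]%n≡m%n i ℓ)

  segment : ∀ {T : Fin n → Set} i k → (∀ j → j ≤ k → T (c (i + j))) → Walk H T (c i) (c (i + k)) k
  segment {T} i zero    t = subst (λ v → Walk H T (c i) v 0) (cong c (≡-sym (+-identityʳ i)))
    (nil (subst (T ∘ c) (+-identityʳ i) (t 0 z≤n)))
  segment {T} i (suc k) t = cons (subst (T ∘ c) (+-identityʳ i) (t 0 z≤n)) (c-adj i)
    (subst (λ j → Walk H T (c (suc i)) (c j) k) (≡-sym (+-suc i k))
      (segment (suc i) k λ j j≤k → subst (T ∘ c) (+-suc i j) (t (suc j) (s≤s j≤k))))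

  odd-closed : ∀ {v k} → parity k ≡ true → Walk H Everywhere v v k → ℓ ≤ k
  odd-closed {v} {k} e p with odd-form k e
  ... | q , refl = s≤s (shortest q v p ⊕ shortest q v p)

  parity-L : parity L ≡ true
  parity-L = trans (cong parity (+-suc r r)) (cong not (double-even r))

  parity-ℓ : parity ℓ ≡ true
  parity-ℓ = trans (Bool.not-involutive (parity L)) parity-L

  -- A repeated vertex would split the closed walk into two closed walks of lengths p and ℓ - p; one
  -- of them is odd and too short.
  c-≢ : ∀ i p → 0 < p → p < ℓ → c (i + p) ≢ c i
  c-≢ i p 0<p p<ℓ e with parity p in odd
  ... | true  = <⇒≱ p<ℓ (odd-closed odd (subst (λ v → Walk H Everywhere (c i) v p) e (segment i p λ _ _ → tt)))
  ... | false = <⇒≱ (∸-monoʳ-< 0<p (<⇒≤ p<ℓ)) (odd-closed odd′ back)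
    where
    odd′ : parity (ℓ ∸ p) ≡ true
    odd′ = trans (cong (_xor parity (ℓ ∸ p)) (≡-sym odd))
      (trans (≡-sym (parity-+ p (ℓ ∸ p))) (trans (cong parity (m+[n∸m]≡n (<⇒≤ p<ℓ))) parity-ℓ))
    round : c (i + p + (ℓ ∸ p)) ≡ c (i + p)
    round = trans (cong c (trans (+-assoc i p (ℓ ∸ p)) (cong (i +_) (m+[n∸m]≡n (<⇒≤ p<ℓ))))) (trans (c-period i) (≡-sym e))
    back : Walk H Everywhere (c (i + p)) (c (i + p)) (ℓ ∸ p)
    back = subst (λ v → Walk H Everywhere (c (i + p)) v (ℓ ∸ p)) round (segment (i + p) (ℓ ∸ p) λ _ _ → tt)

  private
    c-≢-< : ∀ g {i j} → i < j → j < ℓ → c (j + g) ≢ c (i + g)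
    c-≢-< g {i} {j} i<j j<ℓ e = c-≢ (i + g) (j ∸ i) (m<n⇒0<n∸m i<j) (≤-<-trans (m∸n≤m j i) j<ℓ)
      (trans (cong c shift) e)
      where
      shift : i + g + (j ∸ i) ≡ j + g
      shift = trans (+-assoc i g (j ∸ i)) (trans (cong (i +_) (+-comm g (j ∸ i)))
        (trans (≡-sym (+-assoc i (j ∸ i) g)) (cong (_+ g) (m+[n∸m]≡n (<⇒≤ i<j)))))

  c-injective : ∀ g {i j} → i < ℓ → j < ℓ → c (i + g) ≡ c (j + g) → i ≡ j
  c-injective g {i} {j} i<ℓ j<ℓ e with <-cmp i j
  ... | tri< i<j _ _ = ⊥-elim (c-≢-< g i<j j<ℓ (≡-sym e))
  ... | tri≈ _ i≡j _ = i≡j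
  ... | tri> _ _ j<i = ⊥-elim (c-≢-< g j<i i<ℓ e)

  c-injective₀ : ∀ {i j} → i < ℓ → j < ℓ → c i ≡ c j → i ≡ j
  c-injective₀ {i} {j} i<ℓ j<ℓ e = c-injective 0 i<ℓ j<ℓ
    (trans (cong c (+-identityʳ i)) (trans e (cong c (≡-sym (+-identityʳ j)))))

  ℓ≤n : ℓ ≤ n
  ℓ≤n = atMost-injective {P = Everywhere} c c-injective₀ atMost-Fin (λ _ _ → tt)

  OnC OffC : Fin n → Set
  OnC v  = Σ ℕ λ i → i < ℓ × v ≡ c i
  OffC v = ∀ i → i < ℓ → v ≢ c i

  onC : ∀ v → OnC v ⊎ OffC v
  onC v with anyUpTo? (λ i → v F.≟ c i) ℓ
  ... | yes (i , i<ℓ , e) = inj₁ (i , i<ℓ , e)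
  ... | no none = inj₂ λ i i<ℓ e → none (i , i<ℓ , e)

  -- An odd cycle cannot be properly 2-coloured, so it meets the deleted vertex.
  transversal : ∀ {y col} → ProperOff H y col → OnC y
  transversal {y} {col} proper with onC y
  ... | inj₁ on = on
  ... | inj₂ off = ⊥-elim (Bool.not-¬ {col (c 0)} refl
      (trans (≡-sym (cong col (c-period 0)))
        (trans (walk-colour col proper (segment 0 ℓ avoid)) (cong (_xor col (c 0)) parity-ℓ))))
    where
    avoid : ∀ j → j ≤ ℓ → c j ≢ y
    avoid j _ e = off (j % ℓ) (m%n<n j ℓ)
      (trans (≡-sym e) (cong (at W) (≡-sym (m<n⇒m%n≡m (m%n<n j ℓ)))))

  -- The two cycle neighbours of y are joined by the remaining L edges of the cycle. Any other walk
  -- between them in H - y has the same parity by the 2-colouring, so closing it through y gives an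
  -- odd closed walk, of length at least ℓ = L + 2.
  rim : ∀ {y col} → ProperOff H y col → Σ _ λ u → Σ _ λ v → Dist H (_≢ y) u v L
  rim {y} {col} proper with transversal proper
  ... | s , s<ℓ , refl = c (suc s) , c (suc s + L) , path , lower
    where
    path = segment (suc s) L (λ j j≤L → subst (λ i → c i ≢ c s) (+-suc s j) (c-≢ s (suc j) (s≤s z≤n) (s≤s (s≤s j≤L))))
    close : Adj H (c (suc s + L)) (c s)
    close = subst (Adj H (c (suc s + L))) (trans (cong c (trans (cong suc (≡-sym (+-suc s L))) (≡-sym (+-suc s (suc L))))) (c-period s)) (c-adj (suc s + L))
    cancel : ∀ a b x → a xor x ≡ b xor x → a ≡ b
    cancel false false x _ = refl
    cancel true true x _ = refl
    cancel false true false ()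
    cancel false true true ()
    cancel true false false ()
    cancel true false true ()
    lower : ∀ k → Walk H (_≢ c s) (c (suc s)) (c (suc s + L)) k → L ≤ k
    lower k p = s≤s⁻¹ (s≤s⁻¹ (odd-closed odd
      (cons tt (c-adj s) (walk-snoc (walk-⊆ (λ _ _ → tt) p) close tt))))
      where
      odd : parity (suc (suc k)) ≡ true
      odd = trans (Bool.not-involutive (parity k))
        (trans (cancel _ _ (col (c (suc s))) (trans (≡-sym (walk-colour col proper p)) (walk-colour col proper path))) parity-L)

  -- A spanning forest rooted at the cycle

  distances : Level H Everywhere (c 0) n
  distances = level H (λ _ → yes tt) (c 0) n
  open Level distances

  private
    Closer : Fin n → Fin n → Set
    Closer v w = Adj H v w × lev v ≡ suc (lev w)

    closer? : ∀ v → Dec (∃ (Closer v))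
    closer? v = F.any? λ w → adj? H v w ×-dec (lev v ≟ suc (lev w))

    pick : ∀ {v} → Dec (∃ (Closer v)) → Fin n
    pick         (yes (w , _)) = w
    -- Without a closer neighbour v is its own parent; the adjacency demanded by `child` excludes
    -- this default.
    pick {v = v} (no _)        = v

    pick-closer : ∀ {v} (d : Dec (∃ (Closer v))) → ∃ (Closer v) → Closer v (pick d)
    pick-closer (yes (_ , p)) _ = p
    pick-closer (no none)     e = ⊥-elim (none e)

    closer : ∀ {v k} → lev v ≡ suc k → lev v < n → ∃ (Closer v)
    closer {v} {k} e v<n with lev v | e | walk-rev (lev-walk v v<n)
    ... | _ | refl | cons {v = w} _ vw p =
      w , vw , cong suc (≤-antisym (s≤s⁻¹ (subst (_≤ suc (lev w)) e (lev-lip tt (adj-sym H vw)))) (lev-min (walk-rev p)))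

  parent : Fin n → Fin n
  parent v = pick (closer? v)

  -- Hang z v e : v lies at depth e of the tree rooted at z in a spanning forest
  -- whose roots are the vertices of the cycle.
  data Hang : Fin n → Fin n → ℕ → Set where
    root  : ∀ {z} → OnC z → Hang z z 0
    child : ∀ {z v e} → OffC v → Adj H v (parent v) → Hang z (parent v) e → Hang z v (suc e)

  -- Each parent is one level closer to `c 0`; the descent stops on the cycle, at the latest at
  -- `c 0`, the only vertex of level 0.
  hang : ∀ v → lev v < n → Σ _ λ z → Σ ℕ λ e → Hang z v e
  hang v = go (lev v) v refl
    where
    go : ∀ k v → lev v ≡ k → lev v < n → Σ _ λ z → Σ ℕ λ e → Hang z v e
    go k v e v<n with onC v
    ... | inj₁ on = v , 0 , root on
    go zero v e v<n | inj₂ off with lev v | e | lev-walk v v<n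
    ... | _ | refl | nil _ = ⊥-elim (off 0 z<s refl)
    go (suc k) v e v<n | inj₂ off with pick-closer (closer? v) (closer e v<n)
    ... | vw , le with go k (parent v) (suc-injective (trans (≡-sym le) e)) (≤-trans (n≤1+n _) (subst (_< n) le v<n))
    ...   | z , d , h = z , suc d , child off vw h

  hang-unique : ∀ {z z′ v e e′} → Hang z v e → Hang z′ v e′ → z ≡ z′ × e ≡ e′
  hang-unique (root _) (root _) = refl , refl
  hang-unique (root (i , i<ℓ , eq)) (child off _ _) = ⊥-elim (off i i<ℓ eq)
  hang-unique (child off _ _) (root (i , i<ℓ , eq)) = ⊥-elim (off i i<ℓ eq)
  hang-unique (child _ _ h) (child _ _ h′) with hang-unique h h′
  ... | refl , refl = refl , refl

  hang-root : ∀ {z v e} → Hang z v e → OnC z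
  hang-root (root on) = on
  hang-root (child _ _ h) = hang-root h

  hang-off : ∀ {z v e} → Hang z v (suc e) → OffC v
  hang-off (child off _ _) = off

  -- Only the root of a tree lies on the cycle, so deleting another cycle vertex leaves the branch
  -- intact.
  hang-walk : ∀ {z v e y} → OnC y → z ≢ y → Hang z v e → Walk H (_≢ y) v z e
  hang-walk on z≢y (root _) = nil z≢y
  hang-walk on@(i , i<ℓ , eq) z≢y (child off a h) = cons (λ { refl → off i i<ℓ eq }) a (hang-walk on z≢y h)

  ancestor : ∀ {z v s} e → e ≤ s → Hang z v s → Σ _ λ w → Hang z w e
  ancestor {v = v} {s} e e≤s h with m≤n⇒m<n∨m≡n e≤s
  ... | inj₂ refl = v , h
  ancestor e e≤s (child _ _ h) | inj₁ (s≤s lt) = ancestor e lt h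

  -- y is charged to v when y is the cycle vertex at distance g e before the root of v.
  Charged : (ℕ → ℕ) → Fin n → Fin n → Set
  Charged g y v = Σ _ λ z → Σ ℕ λ e → Σ ℕ λ t → Hang z v e × t < ℓ × y ≡ c t × z ≡ c (t + g e)

  charged-injective : ∀ g {y y′ v} → Charged g y v → Charged g y′ v → y ≡ y′
  charged-injective g (z , e , t , h , t<ℓ , refl , z≡) (z′ , e′ , t′ , h′ , t′<ℓ , refl , z≡′) with hang-unique h h′
  ... | refl , refl = cong c (c-injective (g e) t<ℓ t′<ℓ (trans (≡-sym z≡) z≡′))

  -- An off-cycle vertex at depth e marks at most three cycle vertices: its root, and the vertices e
  -- steps before and e steps after the root. Hence the bound 3ρ.
  Marked : Fin n → Set
  Marked y = (Σ _ λ v → OffC v × Charged (λ _ → 0) y v)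
    ⊎ ((Σ _ λ v → OffC v × Charged (λ e → e) y v) ⊎ (Σ _ λ v → OffC v × Charged (ℓ ∸_) y v))

  module _ {ρ} (ρ+ℓ≡n : ρ + ℓ ≡ n) where

    atMost-OffC : AtMost ρ OffC
    atMost-OffC = atMost-avoid c c-injective₀ ρ+ℓ≡n

    atMost-Marked : AtMost (ρ + (ρ + ρ)) Marked
    atMost-Marked = atMost-⊎ (one _) (atMost-⊎ (one _) (one _))
      where
      one : ∀ g → AtMost ρ (λ y → Σ _ λ v → OffC v × Charged g y v)
      one g = atMost-image (Charged g) (charged-injective g) (λ _ x → x) atMost-OffC

    -- If u has depth at least p, its ancestor at depth p marks `c t`; likewise for v and ℓ - p′.
    -- Otherwise both branches and the arc between their roots form a walk of length at most (p - 1)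
    -- + (p′ - p) + (ℓ - p′ - 1) = L avoiding `c t`.
    between : ∀ t → t < ℓ → ∀ {u v d z z′ s s′} p p′ → Dist H (_≢ c t) u v d → suc L ≤ d →
      Hang z u s → Hang z′ v s′ → z ≡ c (t + p) → z′ ≡ c (t + p′) → 0 < p → p ≤ p′ → p′ < ℓ → Marked (c t)
    between t t<ℓ {s = s} {s′} p p′ (_ , min) L<d h h′ refl refl 0<p p≤p′ p′<ℓ with p ≤? s
    ... | yes p≤s with ancestor p p≤s h
    ...   | w , hw = inj₂ (inj₁ (w , off p 0<p hw , _ , p , t , hw , t<ℓ , refl , refl))
      where
      off : ∀ {z w} p → 0 < p → Hang z w p → OffC w
      off (suc _) _ = hang-off
    between t t<ℓ {s = s} {s′} p p′ (_ , min) L<d h h′ refl refl 0<p p≤p′ p′<ℓ | no p≰s with (ℓ ∸ p′) ≤? s′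
    ... | yes e≤s′ with ancestor (ℓ ∸ p′) e≤s′ h′
    ...   | w , hw = inj₂ (inj₂ (w , off (ℓ ∸ p′) (m<n⇒0<n∸m p′<ℓ) hw , _ , ℓ ∸ p′ , t , hw , t<ℓ , refl ,
              cong (c ∘ (t +_)) (≡-sym (m∸[m∸n]≡n (<⇒≤ p′<ℓ)))))
      where
      off : ∀ {z w} p → 0 < p → Hang z w p → OffC w
      off (suc _) _ = hang-off
    between t t<ℓ {d = d} {s = s} {s′} p p′ (_ , min) L<d h h′ refl refl 0<p p≤p′ p′<ℓ | no p≰s | no e≰s′ =
      ⊥-elim (short (p′ ∸ p) (m+[n∸m]≡n p≤p′) (ℓ ∸ p′) (m∸n+n≡m (<⇒≤ p′<ℓ)) (≰⇒> p≰s) (≰⇒> e≰s′)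
        (≤-trans L<d (min _ (walk-++ (hang-walk on (c-≢ t p 0<p (≤-<-trans p≤p′ p′<ℓ)) h)
          (walk-++ along (walk-rev (hang-walk on (c-≢ t p′ (<-≤-trans 0<p p≤p′) p′<ℓ) h′)))))))
      where
      on : OnC (c t)
      on = t , t<ℓ , refl
      along : Walk H (_≢ c t) (c (t + p)) (c (t + p′)) (p′ ∸ p)
      along = subst (λ j → Walk H (_≢ c t) (c (t + p)) (c j) (p′ ∸ p))
        (trans (+-assoc t p (p′ ∸ p)) (cong (t +_) (m+[n∸m]≡n p≤p′)))
        (segment (t + p) (p′ ∸ p) λ j j≤ → subst (λ i → c i ≢ c t) (≡-sym (+-assoc t p j))
          (c-≢ t (p + j) (<-≤-trans 0<p (m≤m+n p j))
            (≤-<-trans (≤-trans (+-monoʳ-≤ p j≤) (≤-reflexive (m+[n∸m]≡n p≤p′))) p′<ℓ)))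
      short : ∀ g → p + g ≡ p′ → ∀ e → e + p′ ≡ ℓ → s < p → s′ < e → suc L ≤ s + (g + s′) → ⊥
      short g refl e eq a b lt = 1+n≰n (linear {b = 0} 0 (a ⊕ b ⊕ lt ⊕ ≤-reflexive eq) (solve (s ∷ s′ ∷ p ∷ e ∷ g ∷ r ∷ [])))

    -- If u were not connected to the cycle, a geodesic with at least L + 2 = ℓ vertices would lie
    -- entirely off the cycle, where there are at most ρ < ℓ vertices.
    grounded : ρ < ℓ → ∀ {y u v d} → Dist H (_≢ y) u v d → suc L ≤ d → lev u < n
    grounded ρ<ℓ {u = u} {d = d} D L<d with lev u <? n
    ... | yes u<n = u<n
    ... | no ≮n = ⊥-elim (<⇒≱ ρ<ℓ (≤-trans (s≤s L<d) (dist-≤ D atMost-OffC off)))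
      where
      off : ∀ i → i ≤ d → OffC (at (proj₁ D) i)
      off i i≤d j j<ℓ e = ≮n (≤-<-trans (lev-min (proj₁ (proj₂ short))) (proj₂ (proj₂ short)))
        where
        short = walk-bounded (λ _ → yes tt) atMost-Fin
          (walk-++ (subst (λ w → Walk H Everywhere (c 0) w j) (≡-sym e) (segment 0 j λ _ _ → tt))
            (walk-rev (walk-⊆ (λ _ _ → tt) (at-prefix (proj₁ D) i i≤d))))

    offset : ∀ {z} t → t < ℓ → OnC z → z ≢ c t → Σ ℕ λ p → 0 < p × p < ℓ × z ≡ c (t + p)
    offset t t<ℓ (i , i<ℓ , refl) z≢ with <-cmp i t
    ... | tri≈ _ refl _ = ⊥-elim (z≢ refl)
    ... | tri> _ _ t<i = i ∸ t , m<n⇒0<n∸m t<i , ≤-<-trans (m∸n≤m i t) i<ℓ , cong c (≡-sym (m+[n∸m]≡n (<⇒≤ t<i)))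
    -- Going forward from `c t` to z passes the index ℓ.
    ... | tri< i<t _ _ = i + (ℓ ∸ t) , <-≤-trans (m<n⇒0<n∸m t<ℓ) (m≤n+m _ i) ,
      <-≤-trans (+-monoˡ-< (ℓ ∸ t) i<t) (≤-reflexive (m+[n∸m]≡n (<⇒≤ t<ℓ))) ,
      trans (≡-sym (c-period i)) (cong c round)
      where
      round : i + ℓ ≡ t + (i + (ℓ ∸ t))
      round = trans (cong (i +_) (≡-sym (m+[n∸m]≡n (<⇒≤ t<ℓ))))
        (trans (≡-sym (+-assoc i t (ℓ ∸ t))) (trans (cong (_+ (ℓ ∸ t)) (+-comm i t)) (+-assoc t i (ℓ ∸ t))))

    attached : ∀ {t u e} → t < ℓ → Hang (c t) u e → u ≢ c t → Marked (c t)
    attached t<ℓ (root _) u≢ = ⊥-elim (u≢ refl)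
    attached {t} t<ℓ h@(child off _ _) _ = inj₁ (_ , off , _ , _ , t , h , t<ℓ , refl , cong c (≡-sym (+-identityʳ t)))

    -- An end that hangs on the deleted vertex marks it by itself. Otherwise the two roots are
    -- ordered by their offsets from the deleted vertex and `between` applies.
    far⇒marked : ρ < ℓ → ∀ {y} → OnC y → Far H y (suc L) → Marked y
    far⇒marked ρ<ℓ {y} (t , t<ℓ , refl) (u , v , d , D , L<d)
      with hang u (grounded ρ<ℓ D L<d) | hang v (grounded ρ<ℓ (dist-sym D) L<d)
    ... | z , _ , h | z′ , _ , h′ with z F.≟ c t | z′ F.≟ c t
    ...   | yes refl | _        = attached t<ℓ h (walk-start (proj₁ D))
    ...   | no _     | yes refl = attached t<ℓ h′ (walk-end (proj₁ D))
    ...   | no z≢    | no z′≢ with offset t t<ℓ (hang-root h) z≢ | offset t t<ℓ (hang-root h′) z′≢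
    ...     | p , 0<p , p<ℓ , e | p′ , 0<p′ , p′<ℓ , e′ with ≤-total p p′
    ...       | inj₁ p≤p′ = between t t<ℓ p p′ D L<d h h′ e e′ 0<p p≤p′ p′<ℓ
    ...       | inj₂ p′≤p = between t t<ℓ p′ p (dist-sym D) L<d h′ h e′ e 0<p′ p′≤p p<ℓ

-- Isomorphic cards

-- An isomorphism from G - x to H - y, written on the full vertex sets and constrained only off x
-- and y, to match walks and distances inside `_≢ x`.
record OffIso {n} (G : Graph n) (x : Fin n) (H : Graph n) (y : Fin n) : Set where
  field
    to      : Fin n → Fin n
    from    : Fin n → Fin n
    to-≢    : ∀ {v} → v ≢ x → to v ≢ y
    from-≢  : ∀ {v} → v ≢ y → from v ≢ x
    to-from : ∀ {v} → v ≢ y → to (from v) ≡ v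
    from-to : ∀ {v} → v ≢ x → from (to v) ≡ v
    to-adj  : ∀ {u v} → u ≢ x → v ≢ x → adj G u v ≡ adj H (to u) (to v)

module _ {n} {G H : Graph n} {x y : Fin n} where
  open OffIso

  offIso-sym : OffIso G x H y → OffIso H y G x
  offIso-sym i = record
    { to = from i ; from = to i ; to-≢ = from-≢ i ; from-≢ = to-≢ i ; to-from = from-to i ; from-to = to-from i
    ; to-adj = λ u≢ v≢ → ≡-sym (trans (to-adj i (from-≢ i u≢) (from-≢ i v≢)) (cong₂ (adj H) (to-from i u≢) (to-from i v≢))) }

  walk-to : (i : OffIso G x H y) → ∀ {u v k} → Walk G (_≢ x) u v k → Walk H (_≢ y) (to i u) (to i v) k
  walk-to i (nil s)      = nil (to-≢ i s)
  walk-to i (cons s e p) = cons (to-≢ i s) (trans (≡-sym (to-adj i s (walk-start p))) e) (walk-to i p)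

dist-to : ∀ {n} {G H : Graph n} {x y} (i : OffIso G x H y) → ∀ {u v d} →
  Dist G (_≢ x) u v d → Dist H (_≢ y) (OffIso.to i u) (OffIso.to i v) d
dist-to {G = G} {x = x} i (p , min) = walk-to i p , λ k q →
  min k (subst₂ (λ u v → Walk G (_≢ x) u v k) (OffIso.from-to i (walk-start p)) (OffIso.from-to i (walk-end p))
    (walk-to (offIso-sym i) q))

far-to : ∀ {n} {G H : Graph n} {x y D} → OffIso G x H y → Far G x D → Far H y D
far-to i (u , v , d , dist , D≤d) = _ , _ , d , dist-to i dist , D≤d

proper-to : ∀ {n} {G H : Graph n} {x y} → OffIso G x H y → ((c , _) : Bipartite G) → Σ _ (ProperOff H y)
proper-to i (c , proper) = (λ v → c (OffIso.from i v)) ,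
  λ v≢ w≢ e → proper _ _ (trans (≡-sym (OffIso.to-adj (offIso-sym i) v≢ w≢)) e)

card-offIso : ∀ {k} {G H : Graph (suc k)} {x y} → card G x ≅ card H y → OffIso G x H y
card-offIso {k} {G} {H} {x} {y} (σ , σ-adj) = record
  { to      = λ v → push (v F.≟ x)
  ; from    = λ v → pull (v F.≟ y)
  ; to-≢    = λ {v} v≢ → push-≢ v≢ (v F.≟ x)
  ; from-≢  = λ {v} v≢ → pull-≢ v≢ (v F.≟ y)
  ; to-from = λ {v} v≢ → push-pull v≢ (v F.≟ y) (pull (v F.≟ y) F.≟ x)
  ; from-to = λ {v} v≢ → pull-push v≢ (v F.≟ x) (push (v F.≟ x) F.≟ y)
  ; to-adj  = λ {u} {v} u≢ v≢ → push-adj u≢ v≢ (u F.≟ x) (v F.≟ x) }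
  where
  open Bijection σ using (to; to⁻; injective; surjective)
  V = Fin (suc k)

  to-to⁻ : ∀ j → to (to⁻ j) ≡ j
  to-to⁻ j = proj₂ (surjective j) refl

  to⁻-to : ∀ j → to⁻ (to j) ≡ j
  to⁻-to j = injective (to-to⁻ (to j))

  push : ∀ {v : V} → Dec (v ≡ x) → V
  push (yes _)  = y
  push (no v≢x) = punchIn y (to (punchOut (v≢x ∘ ≡-sym)))

  pull : ∀ {v : V} → Dec (v ≡ y) → V
  pull (yes _)  = x
  pull (no v≢y) = punchIn x (to⁻ (punchOut (v≢y ∘ ≡-sym)))

  push-≢ : ∀ {v} → v ≢ x → (d : Dec (v ≡ x)) → push d ≢ y
  push-≢ v≢ (yes e) = ⊥-elim (v≢ e)
  push-≢ v≢ (no _)  = F.punchInᵢ≢i y _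

  pull-≢ : ∀ {v} → v ≢ y → (d : Dec (v ≡ y)) → pull d ≢ x
  pull-≢ v≢ (yes e) = ⊥-elim (v≢ e)
  pull-≢ v≢ (no _)  = F.punchInᵢ≢i x _

  push-pull : ∀ {v} → v ≢ y → (d : Dec (v ≡ y)) (d′ : Dec (pull d ≡ x)) → push d′ ≡ v
  push-pull v≢ (yes e) _        = ⊥-elim (v≢ e)
  push-pull v≢ (no ne) (yes e)  = ⊥-elim (F.punchInᵢ≢i x _ e)
  push-pull v≢ (no ne) (no ne′) = trans
    (cong (punchIn y ∘ to) (trans (F.punchOut-cong x refl) (F.punchOut-punchIn x)))
    (trans (cong (punchIn y) (to-to⁻ _)) (F.punchIn-punchOut _))

  pull-push : ∀ {v} → v ≢ x → (d : Dec (v ≡ x)) (d′ : Dec (push d ≡ y)) → pull d′ ≡ v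
  pull-push v≢ (yes e) _        = ⊥-elim (v≢ e)
  pull-push v≢ (no ne) (yes e)  = ⊥-elim (F.punchInᵢ≢i y _ e)
  pull-push v≢ (no ne) (no ne′) = trans
    (cong (punchIn x ∘ to⁻) (trans (F.punchOut-cong y refl) (F.punchOut-punchIn y)))
    (trans (cong (punchIn x) (to⁻-to _)) (F.punchIn-punchOut _))

  push-adj : ∀ {u v} → u ≢ x → v ≢ x → (d : Dec (u ≡ x)) (e : Dec (v ≡ x)) →
    adj G u v ≡ adj H (push d) (push e)
  push-adj u≢ v≢ (yes p) _       = ⊥-elim (u≢ p)
  push-adj u≢ v≢ (no _)  (yes p) = ⊥-elim (v≢ p)
  push-adj u≢ v≢ (no p)  (no q)  =
    trans (≡-sym (cong₂ (adj G) (F.punchIn-punchOut _) (F.punchIn-punchOut _))) (σ-adj _ _)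

-- Geodesics of vertex-deleted subgraphs

-- The search follows the given classification and not a decision of `Good`, so of the earlier
-- indices only `Bad` is known.
first : ∀ {Good Bad : ℕ → Set} N → (∀ i → i < N → Good i ⊎ Bad i) →
  (Σ ℕ λ k → k < N × Good k × (∀ i → i < k → Bad i)) ⊎ (∀ i → i < N → Bad i)
first zero class = inj₂ λ i ()
first {Good} {Bad} (suc N) class with first N (λ i i<N → class i (m<n⇒m<1+n i<N))
... | inj₁ (k , k<N , good , below) = inj₁ (k , m<n⇒m<1+n k<N , good , below)
... | inj₂ bad with class N ≤-refl
...   | inj₁ good = inj₁ (N , ≤-refl , good , bad)
...   | inj₂ badN = inj₂ λ i i<1+N → up i (m≤n⇒m<n∨m≡n (s≤s⁻¹ i<1+N))
  where
  up : ∀ i → i < N ⊎ i ≡ N → Bad i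
  up i (inj₁ i<N)  = bad i i<N
  up i (inj₂ refl) = badN

first-good : ∀ {Good Bad : ℕ → Set} {k N} → (∀ i → i < N → Good i ⊎ Bad i) → AtMost k Bad → k < N →
  Σ ℕ λ k → k < N × Good k × (∀ i → i < k → Bad i)
first-good {N = N} class h k<N with first N class
... | inj₁ r   = r
... | inj₂ bad = ⊥-elim (<⇒≱ k<N (atMost-upTo h bad))

-- A geodesic u₀, …, u_L of G − x; f and f′ are the distances in G − x from its two ends,
-- possibly truncated above L.
record Spine {n} (G : Graph n) (x : Fin n) (L : ℕ) : Set where
  field
    f f′    : Fin n → ℕ
    u       : ℕ → Fin n
    u-≢     : ∀ i → i ≤ L → u i ≢ x
    f-u     : ∀ i → i ≤ L → f (u i) ≡ i
    f′-u    : ∀ i → i ≤ L → f′ (u i) ≡ L ∸ i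
    f-lip   : ∀ {v w} → v ≢ x → w ≢ x → Adj G v w → f w ≤ suc (f v)
    f′-lip  : ∀ {v w} → v ≢ x → w ≢ x → Adj G v w → f′ w ≤ suc (f′ v)
    f-walk  : ∀ v → f v ≤ L → Walk G (λ w → w ≢ x × f w ≤ f v) (u 0) v (f v)
    f′-walk : ∀ v → f′ v ≤ L → Walk G (λ w → w ≢ x × f′ w ≤ f′ v) (u L) v (f′ v)
    f+f′    : ∀ v → L ≤ f v + f′ v

module _ {n} {G : Graph n} {x : Fin n} {L : ℕ} where

  spine : ∀ {a b} → Dist G (_≢ x) a b L → Spine G x L
  spine {a} {b} D@(p , min) = record
    { f = lev A ; f′ = lev B ; u = at p ; u-≢ = at-∈ p
    ; f-u    = λ i i≤L → ≤-antisym (lev-min A (at-prefix p i i≤L)) (below i i≤L)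
    ; f′-u   = λ i i≤L → ≤-antisym (lev-min B (walk-rev (at-suffix p i i≤L))) (below′ i i≤L)
    ; f-lip  = λ _ w≢ e → lev-lip A w≢ e
    ; f′-lip = λ _ w≢ e → lev-lip B w≢ e
    ; f-walk = λ v h → inside A v (s≤s h)
    ; f′-walk = λ v h → subst (λ w → Walk G (λ w → w ≢ x × lev B w ≤ lev B v) w v (lev B v)) (≡-sym (at-end p)) (inside B v (s≤s h))
    ; f+f′ = sum }
    where
    open Level
    -- With cut-off L + 1 all levels up to L are exact, and a level that is cut off already exceeds
    -- L, as `sum` requires.
    A = level G (≢-dec x) a (suc L)
    B = level G (≢-dec x) b (suc L)
    inside : ∀ {r} (A : Level G (_≢ x) r (suc L)) v → lev A v < suc L →
      Walk G (λ w → w ≢ x × lev A w ≤ lev A v) r v (lev A v)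
    inside {r} A v h = subst (λ w → Walk G (λ w → w ≢ x × lev A w ≤ lev A v) r w (lev A v)) (at-end q)
      (walk-on q (lev A v) ≤-refl λ j j≤ → at-∈ q j j≤ , ≤-trans (lev-min A (at-prefix q j j≤)) j≤)
      where q = lev-walk A v h
    sum : ∀ v → L ≤ lev A v + lev B v
    sum v with lev A v <? suc L | lev B v <? suc L
    ... | no ≮  | _     = ≤-trans (n≤1+n L) (≤-trans (≮⇒≥ ≮) (m≤m+n _ _))
    ... | yes _ | no ≮  = ≤-trans (n≤1+n L) (≤-trans (≮⇒≥ ≮) (m≤n+m _ _))
    ... | yes s | yes t = min _ (walk-++ (lev-walk A v s) (walk-rev (lev-walk B v t)))
    below : ∀ i → i ≤ L → i ≤ lev A (at p i)
    below i i≤L = +-cancelʳ-≤ (L ∸ i) i _ (≤-trans (≤-reflexive (m+[n∸m]≡n i≤L))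
      (≤-trans (sum (at p i)) (+-monoʳ-≤ (lev A (at p i)) (lev-min B (walk-rev (at-suffix p i i≤L))))))
    below′ : ∀ i → i ≤ L → L ∸ i ≤ lev B (at p i)
    below′ i i≤L = m≤n+o⇒m∸n≤o L i (≤-trans (sum (at p i)) (+-monoˡ-≤ _ (lev-min A (at-prefix p i i≤L))))

  flip : Spine G x L → Spine G x L
  flip s = record
    { f = f′ ; f′ = f ; u = λ i → u (L ∸ i)
    ; u-≢     = λ i _ → u-≢ (L ∸ i) (m∸n≤m L i)
    ; f-u     = λ i i≤L → trans (f′-u (L ∸ i) (m∸n≤m L i)) (m∸[m∸n]≡n i≤L)
    ; f′-u    = λ i _ → f-u (L ∸ i) (m∸n≤m L i)
    ; f-lip   = f′-lip
    ; f′-lip  = f-lip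
    ; f-walk  = f′-walk
    ; f′-walk = λ v h → subst (λ j → Walk G (λ w → w ≢ x × f w ≤ f v) (u j) v (f v)) (≡-sym (n∸n≡0 L)) (f-walk v h)
    ; f+f′    = λ v → subst (L ≤_) (+-comm (f v) (f′ v)) (f+f′ v) }
    where open Spine s

module SpineProps {n} {G : Graph n} {x : Fin n} {L : ℕ} (s : Spine G x L) where
  open Spine s public

  Extra : Fin n → Set
  Extra v = v ≢ x × (∀ i → i ≤ L → v ≢ u i)

  -- As f changes by at most one along an edge, every walk in G - x from a lower to a higher layer
  -- must pass through such a u i.
  Single : ℕ → Set
  Single i = ∀ v → v ≢ x → f v ≡ i → v ≡ u i

  u-injective : ∀ {i j} → i ≤ L → j ≤ L → u i ≡ u j → i ≡ j
  u-injective i≤L j≤L e = trans (≡-sym (f-u _ i≤L)) (trans (cong f e) (f-u _ j≤L))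

  classify : ∀ v → v ≡ x ⊎ ((Σ ℕ λ i → i ≤ L × v ≡ u i) ⊎ Extra v)
  classify v with v F.≟ x | anyUpTo? (λ i → v F.≟ u i) (suc L)
  ... | yes v≡x | _ = inj₁ v≡x
  ... | no v≢x | yes (i , i≤L , e) = inj₂ (inj₁ (i , s≤s⁻¹ i≤L , e))
  ... | no v≢x | no none = inj₂ (inj₂ (v≢x , λ i i≤L e → none (i , s≤s i≤L , e)))

  single : ∀ i → i ≤ L → Single i ⊎ (Σ (Fin n) λ v → Extra v × f v ≡ i)
  single i i≤L with F.any? (λ v → ≢-dec x v ×-dec (f v ≟ i) ×-dec ≢-dec (u i) v)
  ... | yes (v , v≢x , fv , v≢u) = inj₂ (v ,
    (v≢x , λ j j≤L e → v≢u (trans e (cong u (trans (≡-sym (f-u j j≤L)) (trans (cong f (≡-sym e)) fv))))) , fv)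
  ... | no none = inj₁ λ v v≢x fv → decidable-stable (v F.≟ u i) λ v≢u → none (v , v≢x , fv , v≢u)

  f-along : ∀ {a b k} → Walk G (_≢ x) a b k → f b ≤ k + f a
  f-along (nil _) = ≤-refl
  f-along {a} {b} {suc k} (cons {v = v} s e p) = ≤-trans (f-along p)
    (≤-trans (+-monoʳ-≤ k (f-lip s (walk-start p) e)) (≤-reflexive (+-suc k (f a))))

  private
    -- The vertex x followed by the geodesic: L + 2 distinct vertices, which leave at most ρ for
    -- `Extra`.
    g : ℕ → Fin n
    g zero    = x
    g (suc i) = u i

    g-injective : ∀ {i j} → i < suc (suc L) → j < suc (suc L) → g i ≡ g j → i ≡ j
    g-injective {zero}  {zero}  _ _ e = refl
    g-injective {zero}  {suc j} _ q e = ⊥-elim (u-≢ j (s≤s⁻¹ (s≤s⁻¹ q)) (≡-sym e))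
    g-injective {suc i} {zero}  p _ e = ⊥-elim (u-≢ i (s≤s⁻¹ (s≤s⁻¹ p)) e)
    g-injective {suc i} {suc j} p q e = cong suc (u-injective (s≤s⁻¹ (s≤s⁻¹ p)) (s≤s⁻¹ (s≤s⁻¹ q)) e)

  size-≤ : suc (suc L) ≤ n
  size-≤ = atMost-injective {P = Everywhere} g g-injective atMost-Fin (λ _ _ → _)

  module _ {ρ} (ρ+L≡n : ρ + suc (suc L) ≡ n) where

    atMost-Extra : AtMost ρ Extra
    atMost-Extra = atMost-⊆ sub (atMost-avoid g g-injective ρ+L≡n)
      where
      sub : ∀ v → Extra v → ∀ i → i < suc (suc L) → v ≢ g i
      sub v (v≢x , _) zero    _ = v≢x
      sub v (_ , off) (suc i) p = off i (s≤s⁻¹ (s≤s⁻¹ p))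

    -- The neighbours of y on the geodesic sit in three consecutive layers.
    atMost-Adj : ∀ {y} → y ≢ x → AtMost (4 + ρ) (Adj G y)
    atMost-Adj {y} y≢x = atMost-⊆ cover
      (atMost-⊎ (atMost-≡ x) (atMost-⊎ (atMost-≡ (u (f y ∸ 1)))
        (atMost-⊎ (atMost-≡ (u (f y))) (atMost-⊎ (atMost-≡ (u (suc (f y)))) atMost-Extra))))
      where
      cover : ∀ v → Adj G y v → v ≡ x ⊎ (v ≡ u (f y ∸ 1) ⊎ (v ≡ u (f y) ⊎ (v ≡ u (suc (f y)) ⊎ Extra v)))
      cover v yv with classify v
      ... | inj₁ v≡x = inj₁ v≡x
      ... | inj₂ (inj₂ ex) = inj₂ (inj₂ (inj₂ (inj₂ ex)))
      ... | inj₂ (inj₁ (i , i≤L , refl)) with <-cmp i (f y)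
      ...   | tri≈ _ refl _ = inj₂ (inj₂ (inj₁ refl))
      ...   | tri< i<f _ _ = inj₂ (inj₁ (cong u (≡-sym (cong pred
        (≤-antisym (subst (λ t → f y ≤ suc t) (f-u i i≤L) (f-lip (u-≢ i i≤L) y≢x (adj-sym G yv))) i<f)))))
      ...   | tri> _ _ f<i = inj₂ (inj₂ (inj₂ (inj₁ (cong u
        (≤-antisym (subst (_≤ suc (f y)) (f-u i i≤L) (f-lip y≢x (u-≢ i i≤L) yv)) f<i)))))

-- Matched vertices, and one of them with at most two neighbours

module Cards {n m : ℕ} (X : Fin m → Fin n) (X-injective : ∀ {i j} → X i ≡ X j → i ≡ j)
  {μ : ℕ} (μ+m≡n : μ + m ≡ n) where

  Missing : Fin n → Set
  Missing v = ∀ j → v ≢ X j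

  listed : ∀ v → (Σ (Fin m) λ j → v ≡ X j) ⊎ Missing v
  listed v with F.any? (λ j → v F.≟ X j)
  ... | yes r = inj₁ r
  ... | no none = inj₂ λ j e → none (j , e)

  module _ {G : Graph n} {x : Fin n} {L : ℕ} (s : Spine G x L) where
    open SpineProps s

    atMost-missing : (g : ℕ → ℕ) → (∀ {i j} → g i ≡ g j → i ≡ j) → AtMost μ (λ i → g i ≤ L × Missing (u (g i)))
    atMost-missing g inj = atMost-image
      (λ i v → g i ≤ L × v ≡ u (g i))
      (λ { (p , e) (q , e′) → inj (u-injective p q (trans (≡-sym e) e′)) })
      (λ i (p , off) → u (g i) , off , p , refl)
      (atMost-avoid-Fin X X-injective μ+m≡n)

  LowDegree : Graph n → Fin n → Set
  LowDegree G x = Σ _ λ a → Σ _ λ b → ∀ v → Adj G x v → v ≡ a ⊎ v ≡ b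

  module _ (G : Graph n) {L ρ : ℕ} (ρ+L≡n : ρ + suc (suc L) ≡ n) (ρ≤μ : ρ ≤ μ) (big : 5 * μ + 10 ≤ L)
    (geodesic : ∀ j → Σ _ λ a → Σ _ λ b → Dist G (_≢ X j) a b L) where

    -- If three consecutive layers of G - X j₀ are single, the middle vertex can be adjacent only to
    -- the other two and to X j₀. Unmatched vertices, neighbours of X j₀ and layers with extra
    -- vertices spoil at most μ + (4 + ρ) + 3ρ of the L - 1 positions.
    low-degree : ∀ {j₀ j₁} → X j₀ ≢ X j₁ → Σ (Fin m) λ j → LowDegree G (X j)
    low-degree {j₀} {j₁} x≢ = result (first-good {Good = Good} {Bad = Bad} class bound few)
      where
      s : Spine G (X j₀) L
      s = spine (proj₂ (proj₂ (geodesic j₀)))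
      open SpineProps s
      FatAt : ℕ → Set
      FatAt i = Σ (Fin n) λ v → Extra v × f v ≡ i
      Bad Good : ℕ → Set
      Good i = suc (suc i) ≤ L × (Σ (Fin m) λ j → u (suc i) ≡ X j) × ¬ Adj G (X j₀) (u (suc i)) ×
        Single i × Single (suc i) × Single (suc (suc i))
      Bad i = (suc i ≤ L × Missing (u (suc i))) ⊎ ((suc i ≤ L × Adj G (X j₀) (u (suc i))) ⊎
        (FatAt i ⊎ (FatAt (suc i) ⊎ FatAt (suc (suc i)))))
      fat : ∀ (g : ℕ → ℕ) → (∀ {i j} → g i ≡ g j → i ≡ j) → AtMost ρ (FatAt ∘ g)
      fat g inj = atMost-image (λ i v → f v ≡ g i) (λ e e′ → inj (trans (≡-sym e) e′)) (λ i x → x) (atMost-Extra ρ+L≡n)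
      bound : AtMost (μ + ((4 + ρ) + (ρ + (ρ + ρ)))) Bad
      bound = atMost-⊎ (atMost-missing s suc suc-injective)
        (atMost-⊎ (atMost-image (λ i v → suc i ≤ L × v ≡ u (suc i))
            (λ { (p , e) (q , e′) → suc-injective (u-injective p q (trans (≡-sym e) e′)) })
            (λ i (p , a) → u (suc i) , a , p , refl)
            (SpineProps.atMost-Adj other ρ+L≡n x≢))
          (atMost-⊎ (fat (λ i → i) (λ e → e)) (atMost-⊎ (fat suc suc-injective)
            (fat (suc ∘ suc) (suc-injective ∘ suc-injective)))))
        where
        -- The degree of X j₀ is bounded along a geodesic of a graph that still contains X j₀.
        other : Spine G (X j₁) L
        other = spine (proj₂ (proj₂ (geodesic j₁)))
      few : μ + ((4 + ρ) + (ρ + (ρ + ρ))) < pred L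
      few = below-pred {L} (linear 4 (big ⊕ 4 ⊙ ρ≤μ) (solve (μ ∷ ρ ∷ L ∷ [])))
        where
        below-pred : ∀ {b} → suc (suc (μ + ((4 + ρ) + (ρ + (ρ + ρ))))) ≤ b → μ + ((4 + ρ) + (ρ + (ρ + ρ))) < pred b
        below-pred (s≤s p) = p
      class : ∀ i → i < pred L → Good i ⊎ Bad i
      class i i<L = go (suc-<-pred i<L)
        where
        suc-<-pred : ∀ {i b} → i < pred b → suc i < b
        suc-<-pred {b = suc b} p = s≤s p
        go : suc i < L → Good i ⊎ Bad i
        go si<L with listed (u (suc i)) | adj? G (X j₀) (u (suc i)) | single i (<⇒≤ (<⇒≤ si<L)) | single (suc i) (<⇒≤ si<L) | single (suc (suc i)) si<L
        ... | inj₂ off | _ | _ | _ | _ = inj₂ (inj₁ (<⇒≤ si<L , off))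
        ... | inj₁ _ | yes a | _ | _ | _ = inj₂ (inj₂ (inj₁ (<⇒≤ si<L , a)))
        ... | inj₁ _ | no _ | inj₂ t | _ | _ = inj₂ (inj₂ (inj₂ (inj₁ t)))
        ... | inj₁ _ | no _ | inj₁ _ | inj₂ t | _ = inj₂ (inj₂ (inj₂ (inj₂ (inj₁ t))))
        ... | inj₁ _ | no _ | inj₁ _ | inj₁ _ | inj₂ t = inj₂ (inj₂ (inj₂ (inj₂ (inj₂ t))))
        ... | inj₁ j | no a | inj₁ t₀ | inj₁ t₁ | inj₁ t₂ = inj₁ (si<L , j , a , t₀ , t₁ , t₂)
      result : Σ ℕ (λ i → i < pred L × Good i × (∀ t → t < i → Bad t)) → Σ (Fin m) λ j → LowDegree G (X j)
      result (i , _ , (si<L , (j , e) , ¬adj , t₀ , t₁ , t₂) , _) =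
        j , u i , u (suc (suc i)) , λ v a → nbr v (subst (λ w → Adj G w v) (≡-sym e) a)
        where
        si≤L = <⇒≤ si<L
        nbr : ∀ v → Adj G (u (suc i)) v → v ≡ u i ⊎ v ≡ u (suc (suc i))
        nbr v a with v F.≟ X j₀
        ... | yes refl = ⊥-elim (¬adj (adj-sym G a))
        ... | no v≢ with <-cmp (f v) (suc i)
        ...   | tri≈ _ fv _ = ⊥-elim (adj-irrefl G (subst (λ w → Adj G w v) (≡-sym (t₁ v v≢ fv)) a))
        ...   | tri< lt _ _ = inj₁ (t₀ v v≢ (≤-antisym (s≤s⁻¹ lt)
                 (s≤s⁻¹ (subst (_≤ suc (f v)) (f-u (suc i) si≤L) (f-lip v≢ (u-≢ _ si≤L) (adj-sym G a))))))
        ...   | tri> _ _ gt = inj₂ (t₂ v v≢ (≤-antisym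
                 (subst (λ t → f v ≤ suc t) (f-u (suc i) si≤L) (f-lip (u-≢ _ si≤L) v≢ a)) gt))

-- Cutting the cycle through x

module _ {n} {G : Graph n} {x z₁ z₂ : Fin n} {d : ℕ}
  (neighbours : ∀ v → Adj G x v → v ≡ z₁ ⊎ v ≡ z₂) (xz₁ : Adj G x z₁) (xz₂ : Adj G x z₂)
  (D : Dist G (_≢ x) z₁ z₂ d) where

  private
    p = proj₁ D
  open SpineProps (spine D)

  -- Cutting the cycle through x at u (suc i) leaves a geodesic of the same length d.
  detour : ∀ i → suc (suc i) ≤ d → Single (suc i) → Dist G (_≢ u (suc i)) (u i) (u (suc (suc i))) d
  detour i i<d only = subst (Walk G (_≢ u (suc i)) (u i) (u (suc (suc i)))) total path , lower
    where
    t = suc i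
    t<d : t ≤ d
    t<d = <⇒≤ i<d
    u≢ : ∀ {j} → j ≤ d → j ≢ t → u j ≢ u t
    u≢ j≤d j≢t e = j≢t (u-injective j≤d t<d e)
    fz₂ : f z₂ ≡ d
    fz₂ = trans (cong f (≡-sym (at-end p))) (f-u d ≤-refl)
    fz₁ : f z₁ ≡ 0
    fz₁ = f-u 0 z≤n
    left : Walk G (_≢ u t) z₁ (u i) i
    left = walk-on p i (≤-trans (n≤1+n i) t<d) λ j j≤i →
      u≢ (≤-trans j≤i (≤-trans (n≤1+n i) t<d)) (<⇒≢ (s≤s j≤i))
    right : Walk G (_≢ u t) (u (suc t)) z₂ (d ∸ suc t)
    right = walk-from p (suc t) i<d λ j t<j j≤d → u≢ j≤d (λ e → <⇒≢ t<j (≡-sym e))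
    -- Back from u i to z₁, through x to z₂, and back to u (t + 1).
    path : Walk G (_≢ u t) (u i) (u (suc t)) (i + suc (suc (d ∸ suc t)))
    path = walk-++ (walk-rev left) (cons (walk-start left) (adj-sym G xz₁)
      (cons (λ e → u-≢ t t<d (≡-sym e)) xz₂ (walk-rev right)))
    total : i + suc (suc (d ∸ suc t)) ≡ d
    total = trans (+-suc i _) (trans (cong suc (+-suc i _)) (m+[n∸m]≡n i<d))

    -- Height is 1-Lipschitz on G − u t: it unrolls the cycle through x, cut open at u t.
    data Height : Fin n → ℕ → Set where
      centre : Height x (suc d)
      low    : ∀ {v} → v ≢ x → f v < t → Height v (f v + suc (suc d))
      high   : ∀ {v} → v ≢ x → t < f v → Height v (f v)

    height : ∀ v → v ≢ u t → ∃ (Height v)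
    height v v≢u with v F.≟ x
    ... | yes refl = _ , centre
    ... | no v≢x with <-cmp (f v) t
    ...   | tri< lt _ _ = _ , low v≢x lt
    ...   | tri≈ _ e _  = ⊥-elim (v≢u (only v v≢x e))
    ...   | tri> _ _ gt = _ , high v≢x gt

    height-lip : ∀ {v w a b} → Adj G v w → Height v a → Height w b → a ≤ suc b
    height-lip vw centre centre = ⊥-elim (adj-irrefl G vw)
    height-lip {w = w} vw centre (low _ _) = ≤-trans (m≤n+m (suc d) (f w)) (≤-trans (+-monoʳ-≤ (f w) (n≤1+n _)) (n≤1+n _))
    height-lip vw centre (high _ gt) with neighbours _ vw
    ... | inj₁ refl = ⊥-elim (n≮0 (subst (t <_) fz₁ gt))
    ... | inj₂ refl = s≤s (≤-reflexive (≡-sym fz₂))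
    height-lip vw (low _ lt) centre with neighbours _ (adj-sym G vw)
    ... | inj₁ refl = ≤-reflexive (cong (_+ suc (suc d)) fz₁)
    ... | inj₂ refl = ⊥-elim (<⇒≱ lt (subst (t ≤_) (≡-sym fz₂) t<d))
    height-lip vw (high _ gt) centre with neighbours _ (adj-sym G vw)
    ... | inj₁ refl = ⊥-elim (n≮0 (subst (t <_) fz₁ gt))
    ... | inj₂ refl = ≤-trans (≤-reflexive fz₂) (≤-trans (n≤1+n d) (n≤1+n _))
    height-lip vw (low v≢ _) (low w≢ _) = +-monoˡ-≤ (suc (suc d)) (f-lip w≢ v≢ (adj-sym G vw))
    height-lip vw (high v≢ _) (high w≢ _) = f-lip w≢ v≢ (adj-sym G vw)
    height-lip vw (low v≢ lt) (high w≢ gt) = ⊥-elim (<⇒≱ gt (≤-trans (f-lip v≢ w≢ vw) lt))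
    height-lip vw (high v≢ gt) (low w≢ lt) = ⊥-elim (<⇒≱ gt (≤-trans (f-lip w≢ v≢ (adj-sym G vw)) lt))

    height-along : ∀ {v w a b k} → Walk G (_≢ u t) v w k → Height v a → Height w b → a ≤ k + b
    height-along {v} (nil _) ha hb = ≤-reflexive (same ha hb)
      where
      same : ∀ {v a b} → Height v a → Height v b → a ≡ b
      same centre centre = refl
      same centre (low ≢x _) = ⊥-elim (≢x refl)
      same centre (high ≢x _) = ⊥-elim (≢x refl)
      same (low ≢x _) centre = ⊥-elim (≢x refl)
      same (high ≢x _) centre = ⊥-elim (≢x refl)
      same (low _ _) (low _ _) = refl
      same (high _ _) (high _ _) = refl
      same (low _ lt) (high _ gt) = ⊥-elim (<-asym lt gt)
      same (high _ gt) (low _ lt) = ⊥-elim (<-asym lt gt)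
    height-along (cons s e q) ha hb with height _ (walk-start q)
    ... | _ , hc = ≤-trans (height-lip e ha hc) (s≤s (height-along q hc hb))

    lower : ∀ k → Walk G (_≢ u t) (u i) (u (suc t)) k → d ≤ k
    -- The two ends have heights i + d + 2 and i + 2, which differ by d.
    lower k q = linear 0 (subst₂ (λ a b → a + suc (suc d) ≤ k + b) (f-u i i≤d) (f-u (suc t) i<d)
      (height-along q (low (u-≢ i i≤d) (s≤s (≤-reflexive (f-u i i≤d)))) (high (u-≢ (suc t) i<d) (≤-reflexive (≡-sym (f-u (suc t) i<d))))))
      (arith i d k)
      where
      arith : ∀ i d k → i + suc (suc d) + k ≡ k + suc (suc i) + d + 0
      arith = solve-∀
      i≤d : i ≤ d
      i≤d = ≤-trans (n≤1+n i) t<d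

module Detours {n m : ℕ} (X : Fin m → Fin n) (X-injective : ∀ {i j} → X i ≡ X j → i ≡ j)
  {μ : ℕ} (μ+m≡n : μ + m ≡ n) (G : Graph n) {L ρ : ℕ} (ρ+L≡n : ρ + suc (suc L) ≡ n) (ρ≤μ : ρ ≤ μ) (big : 5 * μ + 10 ≤ L)
  (few-far : AtMost (ρ + (ρ + ρ)) (λ v → Σ (Fin m) λ j → v ≡ X j × Far G v (suc L))) where
  open Cards X X-injective μ+m≡n

  -- If d > L, then by `detour` each inner matched vertex that is alone in its layer is among the at
  -- most 3ρ whose deletion creates a distance above L. The other inner indices are unmatched or
  -- share a layer with one of the ρ′ ≤ ρ extra vertices, so d - 1 ≤ μ + 4ρ ≤ 5μ, which is less than
  -- L.
  no-long-detour : ∀ {x z₁ z₂ d} → (∀ v → Adj G x v → v ≡ z₁ ⊎ v ≡ z₂) → Adj G x z₁ → Adj G x z₂ →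
    Dist G (_≢ x) z₁ z₂ d → d ≤ L
  no-long-detour {x} {d = d} neighbours xz₁ xz₂ D = ≮⇒≥ λ L<d →
    1+n≰n (linear {b = 0} 9 (big ⊕ L<d ⊕ pred-≤ {d} (atMost-upTo bound (cover L<d)) ⊕ extra L<d ⊕ 4 ⊙ ρ≤μ) (arith d L μ ρ (n ∸ suc (suc d))))
    where
    s : Spine G x d
    s = spine D
    open SpineProps s
    ρ′ : ℕ
    ρ′ = n ∸ suc (suc d)
    arith : ∀ d L μ ρ ρ′ → (5 * μ + 10 + (suc L + (d + (ρ′ + 4 * ρ)))) + 0 ≡
      (L + (d + (suc (μ + (ρ′ + (ρ + (ρ + ρ)))) + (ρ + 4 * μ)))) + 1 + 9
    arith = solve-∀
    pred-≤ : ∀ {a b} → pred a ≤ b → a ≤ suc b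
    pred-≤ {zero} _ = z≤n
    pred-≤ {suc a} p = s≤s p
    extra : L < d → ρ′ ≤ ρ
    extra L<d = subst (ρ′ ≤_) (trans (cong (_∸ suc (suc L)) (≡-sym ρ+L≡n)) (m+n∸n≡m ρ (suc (suc L)))) (∸-monoʳ-≤ n (s≤s (s≤s (<⇒≤ L<d))))
    FatAt : ℕ → Set
    FatAt i = Σ (Fin n) λ v → Extra v × f v ≡ suc i
    FarAt : ℕ → Set
    FarAt i = suc i ≤ d × (Σ (Fin m) λ j → u (suc i) ≡ X j × Far G (u (suc i)) (suc L))
    bound : AtMost (μ + (ρ′ + (ρ + (ρ + ρ)))) (λ i → (suc i ≤ d × Missing (u (suc i))) ⊎ (FatAt i ⊎ FarAt i))
    bound = atMost-⊎ (atMost-missing s suc suc-injective) (atMost-⊎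
      (atMost-image (λ i v → f v ≡ suc i) (λ e e′ → suc-injective (trans (≡-sym e) e′)) (λ i x → x) (atMost-Extra (m∸n+n≡m size-≤)))
      (atMost-image (λ i v → suc i ≤ d × v ≡ u (suc i))
        (λ { (p , e) (q , e′) → suc-injective (u-injective p q (trans (≡-sym e) e′)) })
        (λ i (p , far) → u (suc i) , far , p , refl) few-far))
    cover : L < d → ∀ i → i < pred d → (suc i ≤ d × Missing (u (suc i))) ⊎ (FatAt i ⊎ FarAt i)
    cover L<d i i<d = go (suc-<-pred i<d)
      where
      suc-<-pred : ∀ {i b} → i < pred b → suc i < b
      suc-<-pred {b = suc b} p = s≤s p
      go : suc i < d → (suc i ≤ d × Missing (u (suc i))) ⊎ (FatAt i ⊎ FarAt i)
      go si<d with listed (u (suc i)) | single (suc i) (<⇒≤ si<d)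
      ... | inj₂ off | _ = inj₁ (<⇒≤ si<d , off)
      ... | inj₁ _ | inj₂ fat = inj₂ (inj₁ fat)
      ... | inj₁ (j , e) | inj₁ only = inj₂ (inj₂ (<⇒≤ si<d , j , e , _ , _ , d , detour neighbours xz₁ xz₂ D i si<d only , L<d))

-- The two ends of a geodesic

module Side {n} {G : Graph n} {x : Fin n} {L : ℕ} (s : Spine G x L) where
  open SpineProps s

  Low : ℕ → Fin n → Set
  Low k v = v ≢ x × f v < k

  low? : ∀ k v → Dec (Low k v)
  low? k v = ≢-dec x v ×-dec (f v <? k)

  root-walk : ∀ {k v} → k ≤ L → Low k v → Walk G (Low k) (u 0) v (f v)
  root-walk k≤L (v≢x , fv<k) =
    walk-⊆ (λ _ (w≢x , fw≤) → w≢x , ≤-<-trans fw≤ fv<k) (f-walk _ (≤-trans (<⇒≤ fv<k) k≤L))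

  Low-avoids : ∀ {k i v} → k ≤ i → i ≤ L → Low k v → v ≢ u i
  Low-avoids {k} {i} k≤i i≤L (_ , fv<k) refl = <⇒≱ fv<k (subst (k ≤_) (≡-sym (f-u i i≤L)) k≤i)

  atMost-u : ∀ a b → AtMost (b ∸ a) (λ v → Σ ℕ λ i → (a ≤ i × i < b) × v ≡ u i)
  atMost-u a b = atMost-image (λ v i → v ≡ u i) (λ e e′ → trans e (≡-sym e′)) (λ v x → x) (atMost-range a b)

  atMost-Low : ∀ {k a} → k ≤ L → AtMost a (λ v → Extra v × f v < k) → AtMost (k + a) (Low k)
  atMost-Low {k} k≤L few = atMost-⊆ cover (atMost-⊎ (atMost-u 0 k) few)
    where
    cover : ∀ v → Low k v → (Σ ℕ λ i → (0 ≤ i × i < k) × v ≡ u i) ⊎ (Extra v × f v < k)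
    cover v (v≢x , fv<k) with classify v
    ... | inj₁ v≡x = ⊥-elim (v≢x v≡x)
    ... | inj₂ (inj₁ (i , i≤L , refl)) = inj₁ (i , (z≤n , subst (_< k) (f-u i i≤L) fv<k) , refl)
    ... | inj₂ (inj₂ ex) = inj₂ (ex , fv<k)

  -- A shortest walk from u 0 to w passes layer k, hence u k, and it never rises above the layer of
  -- w, so it misses u i.
  climb : ∀ {k i w} → k ≤ f w → f w < i → i ≤ L → Single k → Walk G (_≢ u i) (u k) w (f w ∸ k)
  climb {k} {i} {w} k≤fw fw<i i≤L only =
    walk-⊆ (λ v (_ , fv≤) → λ { refl → <⇒≱ fw<i (subst (_≤ f w) (f-u i i≤L) fv≤) })
      (subst (λ v → Walk G (λ t → t ≢ x × f t ≤ f w) v w (f w ∸ k)) met (at-suffix q k k≤fw))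
    where
    q = f-walk w (≤-trans (<⇒≤ fw<i) i≤L)
    q′ = walk-⊆ (λ _ → proj₁) (at-prefix q k k≤fw)
    met : at q k ≡ u k
    met = only (at q k) (proj₁ (at-∈ q k k≤fw)) (≤-antisym
      (≤-trans (f-along q′) (≤-reflexive (trans (cong (k +_) (f-u 0 z≤n)) (+-identityʳ k))))
      (+-cancelˡ-≤ (f w ∸ k) k _ (≤-trans (≤-reflexive (m∸n+n≡m k≤fw))
        (f-along (walk-⊆ (λ _ → proj₁) (at-suffix q k k≤fw))))))

  -- The walk cannot skip layer k, whose only vertex is u k; it is split at its first visit there.
  cross : ∀ {k a b m} → Single k → Walk G (_≢ x) a b m → f a < k → k ≤ f b →
    Σ (Fin n) λ c → Σ ℕ λ t → Σ ℕ λ r → Walk G (Low k) a c t × Adj G c (u k) × Walk G (_≢ x) (u k) b r × suc t + r ≡ m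
  cross only (nil _) fa<k k≤fb = ⊥-elim (<⇒≱ fa<k k≤fb)
  cross {k} {a} only (cons {v = v} a≢x e p) fa<k k≤fb with f v <? k
  ... | yes fv<k with cross only p fv<k k≤fb
  ...   | c , t , r , q , ck , rest , eq = c , suc t , r , cons (a≢x , fa<k) e q , ck , rest , cong suc eq
  cross {k} {a} only (cons {v = v} a≢x e p) fa<k k≤fb | no fv≮k
    with only v (walk-start p) (≤-antisym (≤-trans (f-lip a≢x (walk-start p) e) fa<k) (≮⇒≥ fv≮k))
  ... | refl = a , 0 , _ , nil (a≢x , fa<k) , e , p , refl

  -- The part of a walk up to its first visit of u k may be replaced by a short walk below level k.
  abstract
    enter : ∀ {k a b m c} → k ≤ L → Single k → AtMost (k + c) (Low k) → Walk G (_≢ x) a b m → f a < k → k ≤ f b →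
      Σ ℕ λ d → Σ ℕ λ r → Walk G (λ v → Low k v ⊎ v ≡ u k) a (u k) d × Walk G (_≢ x) (u k) b r × d + r ≤ m × d ≤ k + c
    enter {k} k≤L only few p fa<k k≤fb with cross only p fa<k k≤fb
    ... | _ , t , r , q , ck , rest , eq with walk-dist (low? k) q
    ...   | d , D@(q′ , _) , d≤t = suc d , r , walk-snoc (walk-⊆ (λ _ → inj₁) q′) ck (inj₂ refl) , rest ,
      ≤-trans (+-monoˡ-≤ r (s≤s d≤t)) (≤-reflexive eq) , dist-≤ D few (at-∈ q′)

  abstract
    -- Below level k a shortest walk has at most k + c vertices. From level k on, w is reached
    -- through u k, by d steps along the given walk and f w - k < i - k steps of climbing.
    short-walk : ∀ {k c i z w d} → k < i → i ≤ L → Single k → AtMost (k + c) (Low k) →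
      Low k z → Walk G (λ v → Low k v ⊎ v ≡ u k) z (u k) d → Low i w →
      Σ ℕ λ l → Walk G (_≢ u i) z w l × (suc (l + k) ≤ d + i ⊎ suc l ≤ k + c)
    short-walk {k} {c} {i} {z} {w} {d} k<i i≤L only few low-z q (w≢x , fw<i) with f w <? k
    ... | yes fw<k with walk-bounded (low? k) few
            (walk-++ (walk-rev (root-walk (≤-trans (<⇒≤ k<i) i≤L) low-z)) (root-walk (≤-trans (<⇒≤ k<i) i≤L) (w≢x , fw<k)))
    ...   | l , p , l< = l , walk-⊆ (λ _ → Low-avoids (<⇒≤ k<i) i≤L) p , inj₂ l<
    short-walk {k} {c} {i} {z} {w} {d} k<i i≤L only few low-z q (w≢x , fw<i) | no fw≮k =
      d + (f w ∸ k) , walk-++ (walk-⊆ avoid q) (climb (≮⇒≥ fw≮k) fw<i i≤L only) , inj₁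
        (≤-trans (s≤s (≤-reflexive (trans (+-assoc d (f w ∸ k) k) (cong (d +_) (m∸n+n≡m (≮⇒≥ fw≮k))))))
          (≤-trans (≤-reflexive (≡-sym (+-suc d (f w)))) (+-monoʳ-≤ d fw<i)))
      where
      avoid : ∀ v → Low k v ⊎ v ≡ u k → v ≢ u i
      avoid v (inj₁ low)  = Low-avoids (<⇒≤ k<i) i≤L low
      avoid v (inj₂ refl) e = <⇒≢ k<i (u-injective (≤-trans (<⇒≤ k<i) i≤L) i≤L e)

  module _ {ρ} (ρ+L≡n : ρ + suc (suc L) ≡ n) where

    atMost-Low-ρ : ∀ {k} → k ≤ L → AtMost (k + ρ) (Low k)
    atMost-Low-ρ k≤L = atMost-Low k≤L (atMost-⊆ (λ _ → proj₁) (atMost-Extra ρ+L≡n))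

    Near : ℕ → Fin n → Set
    Near i v = Low i v ⊎ v ≡ x

    near? : ∀ i v → Dec (Near i v)
    near? i v with low? i v | v F.≟ x
    ... | yes l | _     = yes (inj₁ l)
    ... | no _  | yes e = yes (inj₂ e)
    ... | no ¬l | no ≢x = no λ { (inj₁ l) → ¬l l ; (inj₂ e) → ≢x e }

    near-walk : ∀ {i z v} → i ≤ L → Low i z → Adj G x z → Near i v → Σ ℕ λ l → Walk G (Near i) (u 0) v l
    near-walk i≤L low-z xz (inj₁ low)  = _ , walk-⊆ (λ _ → inj₁) (root-walk i≤L low)
    near-walk i≤L low-z xz (inj₂ refl) = _ , walk-snoc (walk-⊆ (λ _ → inj₁) (root-walk i≤L low-z)) (adj-sym G xz) (inj₂ refl)

    abstract
      -- The vertices below layer i together with x form a connected set, x being attached through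
      -- z, and there are at most i + ρ + 1 of them.
      same-side : ∀ {i z v w} → i ≤ L → Low i z → Adj G x z → Near i v → Near i w →
        Σ ℕ λ l → Walk G (_≢ u i) v w l × l ≤ i + ρ
      same-side {i} {z} {v} {w} i≤L low-z xz tv tw =
        proj₁ short , walk-⊆ avoid (proj₁ (proj₂ short)) , s≤s⁻¹ (≤-trans (proj₂ (proj₂ short)) (≤-reflexive (+-comm (i + ρ) 1)))
        where
        avoid : ∀ v → Near i v → v ≢ u i
        avoid v (inj₁ low)  = Low-avoids ≤-refl i≤L low
        avoid v (inj₂ refl) e = u-≢ i i≤L (≡-sym e)
        few : AtMost (i + ρ + 1) (Near i)
        few = atMost-⊎ (atMost-Low-ρ i≤L) (atMost-≡ x)
        short : Σ ℕ λ l → Walk G (Near i) v w l × suc l ≤ i + ρ + 1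
        short = walk-bounded (near? i) few (walk-++ (walk-rev (proj₂ (near-walk i≤L low-z xz tv))) (proj₂ (near-walk i≤L low-z xz tw)))

    -- Without such a neighbour, u k would separate the vertices below level k from all
    -- others, and neither part is large enough to contain a geodesic of length L.
    abstract
      side-neighbour : ∀ {k a b} → ρ < k → k + ρ ≤ L → Single k → Dist G (_≢ u k) a b L →
        Σ (Fin n) λ z → Adj G x z × Low k z
      side-neighbour {k} {a} {b} ρ<k k+ρ≤L only D with F.any? (λ z → adj? G x z ×-dec low? k z)
      ... | yes r = r
      ... | no none = ⊥-elim (impossible (low? k a))
        where
        k≤L : k ≤ L
        k≤L = ≤-trans (m≤m+n k ρ) k+ρ≤L
        up : ∀ {v w} → v ≢ u k → w ≢ u k → Adj G v w → Low k v → Low k w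
        up {v} {w} _ w≢u vw (v≢x , fv<k) = w≢x , ≤∧≢⇒< (≤-trans (f-lip v≢x w≢x vw) fv<k) (λ e → w≢u (only w w≢x e))
          where
          w≢x : w ≢ x
          w≢x refl = none (v , adj-sym G vw , v≢x , fv<k)
        High : Fin n → Set
        High v = v ≢ u k × ¬ Low k v
        down : ∀ {v w} → v ≢ u k → w ≢ u k → Adj G v w → High v → High w
        down v≢u w≢u vw (_ , ¬low) = w≢u , λ low → ¬low (up w≢u v≢u (adj-sym G vw) low)
        atMost-High : AtMost (1 + ((suc L ∸ suc k) + ρ)) High
        atMost-High = atMost-⊆ cover (atMost-⊎ (atMost-≡ x) (atMost-⊎ (atMost-u (suc k) (suc L)) (atMost-Extra ρ+L≡n)))
          where
          cover : ∀ v → High v → v ≡ x ⊎ ((Σ ℕ λ i → (suc k ≤ i × i < suc L) × v ≡ u i) ⊎ Extra v)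
          cover v (v≢u , ¬low) with classify v
          ... | inj₁ v≡x = inj₁ v≡x
          ... | inj₂ (inj₂ ex) = inj₂ (inj₂ ex)
          ... | inj₂ (inj₁ (i , i≤L , refl)) = inj₂ (inj₁ (i , (≤∧≢⇒< (≮⇒≥ λ i<k → ¬low (u-≢ i i≤L , subst (_< k) (≡-sym (f-u i i≤L)) i<k)) (λ { refl → v≢u refl }) , s≤s i≤L) , refl))
        impossible : Dec (Low k a) → ⊥
        -- The L + 1 vertices of the geodesic would fit among the at most k + ρ vertices below level
        -- k.
        impossible (yes low) = <⇒≱ (dist-≤ D (atMost-Low-ρ k≤L) (at-closed (proj₁ D) low up)) k+ρ≤L
        -- They would fit among the at most 1 + (L - k) + ρ others, forcing k ≤ ρ.
        impossible (no ¬low) = 1+n≰n (≤-trans (+-monoˡ-≤ (L ∸ k) ρ<k)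
          (≤-trans (≤-reflexive (m+[n∸m]≡n k≤L)) (≤-trans (s≤s⁻¹ (dist-≤ D atMost-High
            (at-closed (proj₁ D) (walk-start (proj₁ D) , ¬low) down))) (≤-reflexive (+-comm (L ∸ k) ρ)))))

-- Geodesics that avoid a middle vertex u i

module Middle {n} {G : Graph n} {x : Fin n} {L : ℕ} (s : Spine G x L) {ρ} (ρ+L≡n : ρ + suc (suc L) ≡ n) (ρ<L : ρ < L)
  {z₁ z₂ : Fin n} (neighbours : ∀ v → Adj G x v → v ≡ z₁ ⊎ v ≡ z₂) (xz₁ : Adj G x z₁) (xz₂ : Adj G x z₂)
  {k l a b : ℕ} (ρ<k : ρ < k) (ρ<l : ρ < l) (k+l≤L : k + l ≤ L) where
  private
    module A = Side s
    module B = Side (flip s)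
    module S = SpineProps s
    module S′ = SpineProps (flip s)
  open S using (f; f′; u)

  k≤L : k ≤ L
  k≤L = ≤-trans (m≤m+n k l) k+l≤L
  l≤L : l ≤ L
  l≤L = ≤-trans (m≤n+m l k) k+l≤L

  module _ (low₁ : A.Low k z₁) (low₂ : B.Low l z₂) (single-k : S.Single k) (single-l : S′.Single l)
    (few-a : AtMost (k + a) (A.Low k)) (few-b : AtMost (l + b) (B.Low l))
    {p q : ℕ} (walk-p : Walk G (λ v → A.Low k v ⊎ v ≡ u k) z₁ (u k) p)
    (walk-q : Walk G (λ v → B.Low l v ⊎ v ≡ u (L ∸ l)) z₂ (u (L ∸ l)) q)
    (p+q<k+l : p + q < k + l) where

    abstract
      -- Two vertices on the same side of u i are closer than L, so v and w lie on opposite sides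
      -- and are joined through z₁, x and z₂. If both have to be reached by climbing, p + q < k + l
      -- makes this walk shorter than L. So an end lies below level k or l, and each alternative
      -- says what this means for i or L.
      middle : ∀ {i} → k < i → i ≤ L → l < L ∸ i → S.Single i → S′.Single (L ∸ i) →
        ∀ {v w} → Dist G (_≢ u i) v w L →
        i + l ≤ k + a + q ⊎ ((L ∸ i) + k ≤ l + b + p ⊎ L ≤ (k + a) + (l + b))
      middle {i} k<i i≤L l<j only only′ {v} {w} D =
        locate (side v (walk-start (proj₁ D))) (side w (walk-end (proj₁ D)))
        where
        j : ℕ
        j = L ∸ i
        j≤L : j ≤ L
        j≤L = m∸n≤m L i
        i+j≡L : i + j ≡ L
        i+j≡L = m+[n∸m]≡n i≤L
        uj≡ui : u (L ∸ j) ≡ u i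
        uj≡ui = cong u (m∸[m∸n]≡n i≤L)
        low₁′ : A.Low i z₁
        low₁′ = proj₁ low₁ , <-trans (proj₂ low₁) k<i
        low₂′ : B.Low j z₂
        low₂′ = proj₁ low₂ , <-trans (proj₂ low₂) l<j
        back : ∀ {a b m} → Walk G (_≢ u (L ∸ j)) a b m → Walk G (_≢ u i) a b m
        back = subst (λ t → Walk G (_≢ t) _ _ _) uj≡ui

        -- Vertices beyond u i as seen from both ends. Since f + f′ > L there, all are extra;
        -- neither z₁ nor z₂ is among them, so no edge of G - u i leaves this set.
        Hanging : Fin n → Set
        Hanging v = v ≢ x × i < f v × j < f′ v

        side : ∀ v → v ≢ u i → A.Low i v ⊎ (B.Low j v ⊎ (v ≡ x ⊎ Hanging v))
        side v v≢u with v F.≟ x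
        ... | yes e = inj₂ (inj₂ (inj₁ e))
        ... | no v≢x with <-cmp (f v) i | <-cmp (f′ v) j
        ...   | tri< lt _ _ | _ = inj₁ (v≢x , lt)
        ...   | tri≈ _ e _ | _ = ⊥-elim (v≢u (only v v≢x e))
        ...   | tri> _ _ _ | tri< lt _ _ = inj₂ (inj₁ (v≢x , lt))
        ...   | tri> _ _ _ | tri≈ _ e _ = ⊥-elim (v≢u (trans (only′ v v≢x e) uj≡ui))
        ...   | tri> _ _ gt | tri> _ _ gt′ = inj₂ (inj₂ (inj₂ (v≢x , gt , gt′)))

        same₁ : ∀ {v w} → Dist G (_≢ u i) v w L → A.Low i v ⊎ v ≡ x → A.Low i w ⊎ w ≡ x → ⊥
        same₁ (_ , min) tv tw with A.same-side ρ+L≡n i≤L low₁′ xz₁ tv tw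
        ... | m , walk , m≤ = <⇒≱ (<-≤-trans (+-monoʳ-< i (<-trans ρ<l l<j)) (≤-reflexive i+j≡L)) (≤-trans (min m walk) m≤)

        same₂ : ∀ {v w} → Dist G (_≢ u i) v w L → B.Low j v ⊎ v ≡ x → B.Low j w ⊎ w ≡ x → ⊥
        same₂ (_ , min) tv tw with B.same-side ρ+L≡n j≤L low₂′ xz₂ tv tw
        ... | m , walk , m≤ = <⇒≱ (<-≤-trans (+-monoʳ-< j (<-trans ρ<k k<i)) (≤-reflexive (trans (+-comm j i) i+j≡L)))
          (≤-trans (min m (back walk)) m≤)

        hanging : ∀ {v w} → Dist G (_≢ u i) v w L → Hanging v → ⊥
        hanging D h = <⇒≱ ρ<L (≤-trans (n≤1+n L) (dist-≤ D (S.atMost-Extra ρ+L≡n) λ t t≤L → extra (at-closed (proj₁ D) h stay t t≤L)))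
          where
          stay : ∀ {v w} → v ≢ u i → w ≢ u i → Adj G v w → Hanging v → Hanging w
          stay {v} {w} _ w≢u vw (v≢x , i<f , j<f′) with side w w≢u
          ... | inj₁ (w≢x , lt) = ⊥-elim (<⇒≱ i<f (≤-trans (S.f-lip w≢x v≢x (adj-sym G vw)) lt))
          ... | inj₂ (inj₁ (w≢x , lt)) = ⊥-elim (<⇒≱ j<f′ (≤-trans (S.f′-lip w≢x v≢x (adj-sym G vw)) lt))
          ... | inj₂ (inj₂ (inj₂ h)) = h
          ... | inj₂ (inj₂ (inj₁ refl)) with neighbours v (adj-sym G vw)
          ...   | inj₁ refl = ⊥-elim (<-asym i<f (proj₂ low₁′))
          ...   | inj₂ refl = ⊥-elim (<-asym j<f′ (proj₂ low₂′))
          extra : ∀ {v} → Hanging v → S.Extra v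
          extra (v≢x , i<f , j<f′) = v≢x , λ { t t≤L refl → <⇒≱ (+-mono-< i<f j<f′)
            (≤-reflexive (trans (cong₂ _+_ (S.f-u t t≤L) (S.f′-u t t≤L)) (trans (m+[n∸m]≡n t≤L) (≡-sym i+j≡L)))) }

        opposite : ∀ {v w} → Dist G (_≢ u i) v w L → A.Low i v → B.Low j w →
          i + l ≤ k + a + q ⊎ (j + k ≤ l + b + p ⊎ L ≤ (k + a) + (l + b))
        opposite (_ , min) lv lw
          with A.short-walk k<i i≤L single-k few-a low₁ walk-p lv | B.short-walk l<j j≤L single-l few-b low₂ walk-q lw
        ... | m₁ , w₁ , e₁ | m₂ , w₂ , e₂ = combine e₁ e₂
              (min _ (walk-++ (walk-rev w₁) (cons (walk-start w₁) (adj-sym G xz₁) (cons x≢ xz₂ (back w₂)))))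
          where
          x≢ : x ≢ u i
          x≢ e = S.u-≢ i i≤L (≡-sym e)
          combine : suc (m₁ + k) ≤ p + i ⊎ suc m₁ ≤ k + a → suc (m₂ + l) ≤ q + j ⊎ suc m₂ ≤ l + b →
            L ≤ m₁ + suc (suc m₂) → i + l ≤ k + a + q ⊎ (j + k ≤ l + b + p ⊎ L ≤ (k + a) + (l + b))
          combine (inj₁ h₁) (inj₁ h₂) h = ⊥-elim (1+n≰n (linear {b = 0} 0
            (h₁ ⊕ h₂ ⊕ h ⊕ p+q<k+l ⊕ ≤-reflexive i+j≡L) (arith m₁ m₂ k l p q i j L)))
            where
            arith : ∀ m₁ m₂ k l p q i j L → suc (m₁ + k) + (suc (m₂ + l) + (L + (suc (p + q) + (i + j)))) + 0 ≡
              p + i + (q + j + (m₁ + suc (suc m₂) + (k + l + L))) + 1 + 0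
            arith = solve-∀
          combine (inj₂ h₁) (inj₁ h₂) h = inj₁ (linear 0 (h₁ ⊕ h₂ ⊕ h ⊕ ≤-reflexive i+j≡L) (arith m₁ m₂ k l q i j L a))
            where
            arith : ∀ m₁ m₂ k l q i j L a → suc m₁ + (suc (m₂ + l) + (L + (i + j))) + (k + a + q) ≡
              k + a + (q + j + (m₁ + suc (suc m₂) + L)) + (i + l) + 0
            arith = solve-∀
          combine (inj₁ h₁) (inj₂ h₂) h = inj₂ (inj₁ (linear 0 (h₁ ⊕ h₂ ⊕ h ⊕ ≤-reflexive i+j≡L) (arith m₁ m₂ k l p i j L b)))
            where
            arith : ∀ m₁ m₂ k l p i j L b → suc (m₁ + k) + (suc m₂ + (L + (i + j))) + (l + b + p) ≡
              p + i + (l + b + (m₁ + suc (suc m₂) + L)) + (j + k) + 0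
            arith = solve-∀
          combine (inj₂ h₁) (inj₂ h₂) h = inj₂ (inj₂ (linear 0 (h₁ ⊕ h₂ ⊕ h) (arith m₁ m₂ k l L a b)))
            where
            arith : ∀ m₁ m₂ k l L a b → suc m₁ + (suc m₂ + L) + (k + a + (l + b)) ≡
              k + a + (l + b + (m₁ + suc (suc m₂))) + L + 0
            arith = solve-∀

        locate : A.Low i v ⊎ (B.Low j v ⊎ (v ≡ x ⊎ Hanging v)) → A.Low i w ⊎ (B.Low j w ⊎ (w ≡ x ⊎ Hanging w)) →
          i + l ≤ k + a + q ⊎ (j + k ≤ l + b + p ⊎ L ≤ (k + a) + (l + b))
        locate (inj₂ (inj₂ (inj₂ h))) _ = ⊥-elim (hanging D h)
        locate _ (inj₂ (inj₂ (inj₂ h))) = ⊥-elim (hanging (dist-sym D) h)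
        locate (inj₁ lv) (inj₁ lw) = ⊥-elim (same₁ D (inj₁ lv) (inj₁ lw))
        locate (inj₁ lv) (inj₂ (inj₁ lw)) = opposite D lv lw
        locate (inj₁ lv) (inj₂ (inj₂ (inj₁ e))) = ⊥-elim (same₁ D (inj₁ lv) (inj₂ e))
        locate (inj₂ (inj₁ lv)) (inj₁ lw) = opposite (dist-sym D) lw lv
        locate (inj₂ (inj₁ lv)) (inj₂ (inj₁ lw)) = ⊥-elim (same₂ D (inj₁ lv) (inj₁ lw))
        locate (inj₂ (inj₁ lv)) (inj₂ (inj₂ (inj₁ e))) = ⊥-elim (same₂ D (inj₁ lv) (inj₂ e))
        locate (inj₂ (inj₂ (inj₁ e))) (inj₁ lw) = ⊥-elim (same₁ D (inj₂ e) (inj₁ lw))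
        locate (inj₂ (inj₂ (inj₁ e))) (inj₂ (inj₁ lw)) = ⊥-elim (same₂ D (inj₂ e) (inj₁ lw))
        locate (inj₂ (inj₂ (inj₁ e))) (inj₂ (inj₂ (inj₁ e′))) = ⊥-elim (same₁ D (inj₂ e) (inj₂ e′))

-- The final count

∸-cases : ∀ m n → m ∸ n ≡ 0 ⊎ (m ∸ n) + n ≤ m
∸-cases m n with ≤-total m n
... | inj₁ m≤n = inj₁ (m≤n⇒m∸n≡0 m≤n)
... | inj₂ n≤m = inj₂ (≤-reflexive (m∸n+n≡m n≤m))

-- The differences are a + q - l and b + p - k. If both are positive, their sum is below a + b
-- because p + q < k + l; if only one is, the bound on q or p suffices.
atMost-mid : ∀ {k l a b p q} → p ≤ k + a → q ≤ l + b → p + q < k + l →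
  ((k + a + q) ∸ (l + k)) + ((l + b + p) ∸ (k + l)) ≤ a + b
atMost-mid {k} {l} {a} {b} {p} {q} hp hq h =
  go ((k + a + q) ∸ (l + k)) ((l + b + p) ∸ (k + l)) (∸-cases (k + a + q) (l + k)) (∸-cases (l + b + p) (k + l))
  where
  go : ∀ t₁ t₂ → t₁ ≡ 0 ⊎ t₁ + (l + k) ≤ k + a + q → t₂ ≡ 0 ⊎ t₂ + (k + l) ≤ l + b + p → t₁ + t₂ ≤ a + b
  go _ _ (inj₁ refl) (inj₁ refl) = z≤n
  go t₁ _ (inj₂ h₁) (inj₁ refl) = linear 0 (h₁ ⊕ hq) (arith t₁ k l a b q)
    where
    arith : ∀ t₁ k l a b q → t₁ + (l + k) + q + (a + b) ≡ k + a + q + (l + b) + (t₁ + 0) + 0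
    arith = solve-∀
  go _ t₂ (inj₁ refl) (inj₂ h₂) = linear 0 (h₂ ⊕ hp) (arith t₂ k l a b p)
    where
    arith : ∀ t₂ k l a b p → t₂ + (k + l) + p + (a + b) ≡ l + b + p + (k + a) + t₂ + 0
    arith = solve-∀
  go t₁ t₂ (inj₂ h₁) (inj₂ h₂) = linear 1 (h₁ ⊕ h₂ ⊕ h) (arith t₁ t₂ k l a b p q)
    where
    arith : ∀ t₁ t₂ k l a b p q → t₁ + (l + k) + (t₂ + (k + l) + suc (p + q)) + (a + b) ≡
      k + a + q + (l + b + p + (k + l)) + (t₁ + t₂) + 1
    arith = solve-∀

reflect : ∀ {L i} → i ≤ L → L ∸ (L ∸ i) ≡ i
reflect = m∸[m∸n]≡n

atMost-reflect : ∀ {L k} {P : ℕ → Set} → AtMost k P → AtMost k (λ i → i ≤ L × P (L ∸ i))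
atMost-reflect {L} = atMost-image (λ i t → i ≤ L × t ≡ L ∸ i)
  (λ { (p , e) (q , e′) → trans (≡-sym (reflect p)) (trans (cong (L ∸_) (trans (≡-sym e) e′)) (reflect q)) })
  (λ i (p , h) → L ∸ i , h , p , refl)

atMost-fibre : ∀ {n k} {P : Fin n → Set} (f : Fin n → ℕ) → AtMost k P → AtMost k (λ i → Σ (Fin n) λ v → P v × f v ≡ i)
atMost-fibre f = atMost-image (λ i v → f v ≡ i) (λ e e′ → trans (≡-sym e) e′) (λ i (v , p , e) → v , p , e)

atMost-initial : ∀ ρ → AtMost (suc ρ) (_≤ ρ)
atMost-initial ρ = atMost-⊆ (λ i i≤ρ → z≤n , s≤s i≤ρ) (atMost-range 0 (suc ρ))

two-neighbours : ∀ {n} {G : Graph n} {x z₁ z₂ a b : Fin n} → (∀ v → Adj G x v → v ≡ a ⊎ v ≡ b) →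
  Adj G x z₁ → Adj G x z₂ → z₁ ≢ z₂ → ∀ v → Adj G x v → v ≡ z₁ ⊎ v ≡ z₂
two-neighbours {z₁ = z₁} {z₂} only xz₁ xz₂ z₁≢z₂ v xv with only z₁ xz₁ | only z₂ xz₂ | only v xv
... | inj₁ e | inj₁ e′ | _ = ⊥-elim (z₁≢z₂ (trans e (≡-sym e′)))
... | inj₂ e | inj₂ e′ | _ = ⊥-elim (z₁≢z₂ (trans e (≡-sym e′)))
... | inj₁ e | inj₂ e′ | inj₁ h = inj₁ (trans h (≡-sym e))
... | inj₁ e | inj₂ e′ | inj₂ h = inj₂ (trans h (≡-sym e′))
... | inj₂ e | inj₁ e′ | inj₁ h = inj₂ (trans h (≡-sym e′))
... | inj₂ e | inj₁ e′ | inj₂ h = inj₁ (trans h (≡-sym e))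

-- Both ends are neighbours of x and so have the same colour.
even-walk : ∀ {n} {G : Graph n} {S : Fin n → Set} {x z₁ z₂ d} → Bipartite G → Adj G x z₁ → Adj G x z₂ →
  Walk G S z₁ z₂ d → parity d ≡ false
even-walk {d = d} (c , proper) xz₁ xz₂ p = ¬odd (parity d) (walk-colour c (λ _ _ e → proper _ _ e) p)
  where
  same = trans (Bool.¬-not (λ e → proper _ _ xz₁ (≡-sym e))) (≡-sym (Bool.¬-not (λ e → proper _ _ xz₂ (≡-sym e))))
  ¬odd : ∀ b → c _ ≡ b xor c _ → b ≡ false
  ¬odd false _ = refl
  ¬odd true  e = ⊥-elim (Bool.not-¬ refl (trans same e))

module Starts {n m : ℕ} (X : Fin m → Fin n) (X-injective : ∀ {i j} → X i ≡ X j → i ≡ j)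
  {μ : ℕ} (μ+m≡n : μ + m ≡ n) {G : Graph n} {x : Fin n} {L : ℕ} (s : Spine G x L) (ρ : ℕ) where
  open Cards X X-injective μ+m≡n
  open SpineProps s

  -- `Start` prepares for `side-neighbour`: the index exceeds ρ, u i is alone in its layer, and it
  -- is matched, so that G - u i has a geodesic of length L. `NotStart` lists the ways to fail, each
  -- easy to count.
  FatAt Start NotStart : ℕ → Set
  FatAt i    = Σ (Fin n) λ v → Extra v × f v ≡ i
  Start i    = ρ < i × Single i × (Σ (Fin m) λ j → u i ≡ X j)
  NotStart i = i ≤ ρ ⊎ ((i ≤ L × Missing (u i)) ⊎ FatAt i)

  start : ∀ i → i ≤ L → Start i ⊎ NotStart i
  start i i≤L with ρ <? i | listed (u i) | single i i≤L
  ... | no ρ≮i | _      | _      = inj₂ (inj₁ (≮⇒≥ ρ≮i))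
  ... | yes _  | inj₂ h | _      = inj₂ (inj₂ (inj₁ (i≤L , h)))
  ... | yes _  | inj₁ _ | inj₂ h = inj₂ (inj₂ (inj₂ h))
  ... | yes r  | inj₁ j | inj₁ h = inj₁ (r , h , j)

  exclusive : ∀ {i} → i ≤ L → Start i → NotStart i → ⊥
  exclusive _ (ρ<i , _ , _) (inj₁ i≤ρ) = <⇒≱ ρ<i i≤ρ
  exclusive _ (_ , _ , (j , e)) (inj₂ (inj₁ (_ , h))) = h j e
  exclusive {i} i≤L (_ , only , _) (inj₂ (inj₂ (v , (v≢x , off) , e))) = off i i≤L (only v v≢x e)

  earliest : ∀ {i} → i ≤ L → Start i → Σ ℕ λ k → k ≤ i × Start k × (∀ t → t < k → NotStart t)
  earliest {i} i≤L h with first {Start} {NotStart} (suc i) (λ t t≤i → start t (≤-trans (s≤s⁻¹ t≤i) i≤L))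
  ... | inj₁ (k , k≤i , hk , below) = k , s≤s⁻¹ k≤i , hk , below
  ... | inj₂ none = ⊥-elim (exclusive i≤L h (none i ≤-refl))

module Contradiction {n m : ℕ} (X : Fin m → Fin n) (X-injective : ∀ {i j} → X i ≡ X j → i ≡ j)
  {μ : ℕ} (μ+m≡n : μ + m ≡ n) (G : Graph n) {L ρ : ℕ} (ρ+L≡n : ρ + suc (suc L) ≡ n) (ρ≤μ : ρ ≤ μ) (big : 5 * μ + 10 ≤ L)
  (few-far : AtMost (ρ + (ρ + ρ)) (λ v → Σ (Fin m) λ j → v ≡ X j × Far G v (suc L)))
  (geodesic : ∀ j → Σ _ λ a → Σ _ λ b → Dist G (_≢ X j) a b L)
  (bipartite : Bipartite G) (odd-L : parity L ≡ true) where
  open Cards X X-injective μ+m≡n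

  module _ {x : Fin n} (s : Spine G x L) (low-degree-x : LowDegree G x) where
    private
      module A = Side s
      module B = Side (flip s)
      module S = SpineProps s
      module S′ = SpineProps (flip s)
      module T = Starts X X-injective μ+m≡n s ρ
      module T′ = Starts X X-injective μ+m≡n (flip s) ρ
    open S using (f; f′; u; Extra)

    ρ<L : ρ < L
    ρ<L = linear (9 + 4 * μ) (big ⊕ ρ≤μ) (arith μ L ρ)
      where
      arith : ∀ μ L ρ → 5 * μ + 10 + ρ + L ≡ L + μ + suc ρ + (9 + 4 * μ)
      arith = solve-∀

    unflip : ∀ {v} → S′.Extra v → Extra v
    unflip (v≢x , off) = v≢x , λ i i≤L e → off (L ∸ i) (m∸n≤m L i) (trans e (cong u (≡-sym (reflect i≤L))))

    -- A common index that is a start from both ends guarantees that the earliest starts k and l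
    -- from the two ends satisfy k + l ≤ L.
    doubly : Σ ℕ λ i → i ≤ L × T.Start i × T′.Start (L ∸ i)
    doubly = result (first-good {Good = Good} {Bad = Bad} class
      (atMost-⊎ (atMost-initial ρ) (atMost-⊎ (atMost-reflect (atMost-initial ρ)) (atMost-⊎ (atMost-missing s (λ i → i) (λ e → e))
        (atMost-⊎ (atMost-fibre f (S.atMost-Extra ρ+L≡n)) (atMost-reflect (atMost-fibre f′ (S′.atMost-Extra ρ+L≡n)))))))
      (linear 8 (big ⊕ 4 ⊙ ρ≤μ) (arith μ L ρ)))
      where
      arith : ∀ μ L ρ → 5 * μ + 10 + 4 * ρ + suc L ≡ L + 4 * μ + suc (suc ρ + (suc ρ + (μ + (ρ + ρ)))) + 8
      arith = solve-∀
      Good Bad : ℕ → Set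
      Good i = i ≤ L × T.Start i × T′.Start (L ∸ i)
      Bad i = i ≤ ρ ⊎ ((i ≤ L × L ∸ i ≤ ρ) ⊎ ((i ≤ L × Missing (u i)) ⊎ (T.FatAt i ⊎ (i ≤ L × T′.FatAt (L ∸ i)))))
      class : ∀ i → i < suc L → Good i ⊎ Bad i
      class i i≤L with T.start i (s≤s⁻¹ i≤L) | T′.start (L ∸ i) (m∸n≤m L i)
      ... | inj₁ h | inj₁ h′ = inj₁ (s≤s⁻¹ i≤L , h , h′)
      ... | inj₂ (inj₁ h) | _ = inj₂ (inj₁ h)
      ... | inj₂ (inj₂ (inj₁ h)) | _ = inj₂ (inj₂ (inj₂ (inj₁ h)))
      ... | inj₂ (inj₂ (inj₂ h)) | _ = inj₂ (inj₂ (inj₂ (inj₂ (inj₁ h))))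
      ... | inj₁ _ | inj₂ (inj₁ h) = inj₂ (inj₂ (inj₁ (s≤s⁻¹ i≤L , h)))
      ... | inj₁ _ | inj₂ (inj₂ (inj₁ (_ , h))) = inj₂ (inj₂ (inj₂ (inj₁ (s≤s⁻¹ i≤L , λ j e → h j (trans (cong u (reflect (s≤s⁻¹ i≤L))) e)))))
      ... | inj₁ _ | inj₂ (inj₂ (inj₂ h)) = inj₂ (inj₂ (inj₂ (inj₂ (inj₂ (s≤s⁻¹ i≤L , h)))))
      result : (Σ ℕ λ i → i < suc L × Good i × (∀ t → t < i → Bad t)) → Σ ℕ Good
      result (i , _ , h , _) = i , h

    module _ {k l : ℕ} (k+l≤L : k + l ≤ L) (k≤L : k ≤ L) (l≤L : l ≤ L) (ρ<k : ρ < k) (ρ<l : ρ < l)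
      (single-k : S.Single k) (single-l : S′.Single l)
      (before-k : ∀ t → t < k → T.NotStart t) (before-l : ∀ t → t < l → T′.NotStart t)
      {z₁ z₂ : Fin n} (neighbours : ∀ v → Adj G x v → v ≡ z₁ ⊎ v ≡ z₂) (xz₁ : Adj G x z₁) (xz₂ : Adj G x z₂)
      (low₁ : A.Low k z₁) (low₂ : B.Low l z₂) where

      private
        dist-at : ∀ {i} → (Σ (Fin m) λ j → u i ≡ X j) → Σ _ λ a → Σ _ λ b → Dist G (_≢ u i) a b L
        dist-at (j , e) = subst (λ v → Σ _ λ a → Σ _ λ b → Dist G (_≢ v) a b L) (≡-sym e) (geodesic j)

        -- An extra vertex spoils up to two indices of the geodesic; one that lies in Left or Right
        -- spoils only one, which pays for the indices counted by few-mid.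
        Left Right Rest : Fin n → Set
        Left v  = Extra v × f v < k
        Right v = Extra v × f′ v < l
        Rest v  = Extra v × (¬ (f v < k) × ¬ (f′ v < l))

        extra? : ∀ v → Dec (Extra v)
        extra? v with S.classify v
        ... | inj₁ e = no λ (v≢x , _) → v≢x e
        ... | inj₂ (inj₁ (i , i≤L , e)) = no λ (_ , off) → off i i≤L e
        ... | inj₂ (inj₂ h) = yes h

        left : ∃ (Card Left)
        left = card-of λ v → extra? v ×-dec (f v <? k)
        right : ∃ (Card Right)
        right = card-of λ v → extra? v ×-dec (f′ v <? l)
        rest : ∃ (Card Rest)
        rest = card-of λ v → extra? v ×-dec (¬? (f v <? k) ×-dec ¬? (f′ v <? l))
        a = proj₁ left
        b = proj₁ right
        c = proj₁ rest

        a+b+c≤ρ : a + (b + c) ≤ ρ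
        a+b+c≤ρ = card-≤ (card-⊎ (proj₂ left) (card-⊎ (proj₂ right) (proj₂ rest)
            (λ v (_ , p) (_ , _ , ¬p) → ¬p p))
            (λ { v (_ , p) (inj₁ (_ , q)) → <⇒≱ (+-mono-< p q) (≤-trans k+l≤L (S.f+f′ v))
               ; v (_ , p) (inj₂ (_ , ¬p , _)) → ¬p p }))
          (λ { v (inj₁ (ex , _)) → ex ; v (inj₂ (inj₁ (ex , _))) → ex ; v (inj₂ (inj₂ (ex , _))) → ex })
          (S.atMost-Extra ρ+L≡n)

        few-a : AtMost (k + a) (A.Low k)
        few-a = A.atMost-Low k≤L (atMost (proj₂ left))
        few-b : AtMost (l + b) (B.Low l)
        few-b = B.atMost-Low l≤L (atMost-⊆ (λ v (ex , lt) → unflip ex , lt) (atMost (proj₂ right)))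

        record Mid (i : ℕ) : Set where
          field
            k<i     : k < i
            i≤L     : i ≤ L
            l<L∸i   : l < L ∸ i
            single  : S.Single i
            single′ : S′.Single (L ∸ i)
            label   : Σ (Fin m) λ j → u i ≡ X j

        -- A walk of length d from z₁ to z₂, broken at u k and at u (L - l), with its first and last
        -- pieces shortened: p + t + q ≤ d.
        record Passage (d : ℕ) : Set where
          field
            {p q r t} : ℕ
            p+r≤d  : p + r ≤ d
            q+t≤r  : q + t ≤ r
            p≤     : p ≤ k + a
            q≤     : q ≤ l + b
            walk-p : Walk G (λ v → A.Low k v ⊎ v ≡ u k) z₁ (u k) p
            walk-q : Walk G (λ v → B.Low l v ⊎ v ≡ u (L ∸ l)) z₂ (u (L ∸ l)) q
            across : Walk G (_≢ x) (u (L ∸ l)) (u k) t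

        passage : ∀ {d} → Walk G (_≢ x) z₁ z₂ d → Passage d
        passage {d} walk = join (A.enter k≤L single-k few-a walk (proj₂ low₁) high₂)
          where
          high₂ : k ≤ f z₂
          high₂ = +-cancelʳ-≤ l k (f z₂) (≤-trans k+l≤L (≤-trans (S.f+f′ z₂) (+-monoʳ-≤ (f z₂) (<⇒≤ (proj₂ low₂)))))
          high₁ : l ≤ f′ (u k)
          high₁ = subst (l ≤_) (≡-sym (S.f′-u k k≤L)) (m+n≤o⇒m≤o∸n l (≤-trans (≤-reflexive (+-comm l k)) k+l≤L))
          finish : ∀ {p r} → Walk G (λ v → A.Low k v ⊎ v ≡ u k) z₁ (u k) p → p + r ≤ d → p ≤ k + a →
            (Σ ℕ λ q → Σ ℕ λ t → Walk G (λ v → B.Low l v ⊎ v ≡ u (L ∸ l)) z₂ (u (L ∸ l)) q ×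
              Walk G (_≢ x) (u (L ∸ l)) (u k) t × q + t ≤ r × q ≤ l + b) → Passage d
          finish walk-p p+r≤d p≤ (q , t , walk-q , across , q+t≤r , q≤) = record
            { p+r≤d = p+r≤d ; q+t≤r = q+t≤r ; p≤ = p≤ ; q≤ = q≤ ; walk-p = walk-p ; walk-q = walk-q ; across = across }
          join : (Σ ℕ λ p → Σ ℕ λ r → Walk G (λ v → A.Low k v ⊎ v ≡ u k) z₁ (u k) p ×
            Walk G (_≢ x) (u k) z₂ r × p + r ≤ d × p ≤ k + a) → Passage d
          join (p , r , walk-p , onward , p+r≤d , p≤) =
            finish walk-p p+r≤d p≤ (B.enter l≤L single-l few-b (walk-rev onward) (proj₂ low₂) high₁)

        few-mid : ∀ {d} → Passage d → d < L → AtMost (a + b) Mid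
        few-mid {d} passage d<L = bound (L ≤? (k + a) + (l + b))
          where
          open Passage passage
          -- Crossing from layer k to layer L - l takes at least L - l - k steps; as the whole
          -- passage is shorter than L, too little remains for p + q to reach k + l.
          gap : L ≤ t + (k + l)
          gap = ≤-trans (≤-reflexive (≡-sym (m∸n+n≡m l≤L))) (≤-trans (+-monoˡ-≤ l
            (subst₂ (λ a b → a ≤ t + b) (S.f-u (L ∸ l) (m∸n≤m L l)) (S.f-u k k≤L) (S.f-along (walk-rev across))))
            (≤-reflexive (+-assoc t k l)))
          p+q<k+l : p + q < k + l
          p+q<k+l = linear 0 (gap ⊕ d<L ⊕ p+r≤d ⊕ q+t≤r) (arith p q r t d k l L)
            where
            arith : ∀ p q r t d k l L → L + (suc d + (p + r + (q + t))) + (k + l) ≡ t + (k + l) + (L + (d + r)) + suc (p + q) + 0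
            arith = solve-∀
          bad : ∀ i → Mid i → i + l ≤ k + a + q ⊎ ((L ∸ i) + k ≤ l + b + p ⊎ L ≤ (k + a) + (l + b))
          bad i h = Middle.middle s ρ+L≡n ρ<L neighbours xz₁ xz₂ ρ<k ρ<l k+l≤L low₁ low₂ single-k single-l few-a few-b
            walk-p walk-q p+q<k+l k<i i≤L l<L∸i single single′ (proj₂ (proj₂ (dist-at label)))
            where open Mid h
          bound : Dec (L ≤ (k + a) + (l + b)) → AtMost (a + b) Mid
          -- So few layers lie strictly between k and L - l that all of them may be counted.
          bound (yes narrow) = atMost-≤
              (m≤n+o⇒m∸n≤o (L ∸ l) (suc k) (m≤n+o⇒m∸n≤o L l (≤-trans narrow (linear 1 (z≤n {0}) (arith k l a b)))))
              (atMost-⊆ (λ i h → Mid.k<i h , m+n≤o⇒m≤o∸n (suc i) (≤-trans (+-monoʳ-≤ (suc i) ≤-refl) (within h))) (atMost-range (suc k) (L ∸ l)))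
            where
            arith : ∀ k l a b → 0 + (l + (suc k + (a + b))) ≡ 0 + (k + a + (l + b)) + 1
            arith = solve-∀
            within : ∀ {i} → Mid i → suc i + l ≤ L
            within {i} h = ≤-trans (≤-reflexive (≡-sym (+-suc i l))) (≤-trans (+-monoʳ-≤ i (Mid.l<L∸i h)) (≤-reflexive (m+[n∸m]≡n (Mid.i≤L h))))
          -- Now i is at most a + q - l above k, or L - i is at most b + p - k above l; `atMost-mid`
          -- adds up the two ranges.
          bound (no wide) = atMost-≤ (≤-trans (≤-reflexive (cong₂ _+_ (∸-+-assoc (k + a + q) l k) (∸-+-assoc (l + b + p) k l))) (atMost-mid {k} {l} {a} {b} p≤ q≤ p+q<k+l))
              (atMost-⊆ split (atMost-⊎ (atMost-range (suc k) (suc ((k + a + q) ∸ l))) (atMost-reflect (atMost-range (suc l) (suc ((l + b + p) ∸ k))))))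
            where
            split : ∀ i → Mid i → (suc k ≤ i × i < suc ((k + a + q) ∸ l)) ⊎ (i ≤ L × suc l ≤ L ∸ i × L ∸ i < suc ((l + b + p) ∸ k))
            split i h = choose (bad i h)
              where
              choose : i + l ≤ k + a + q ⊎ ((L ∸ i) + k ≤ l + b + p ⊎ L ≤ (k + a) + (l + b)) →
                (suc k ≤ i × i < suc ((k + a + q) ∸ l)) ⊎ (i ≤ L × suc l ≤ L ∸ i × L ∸ i < suc ((l + b + p) ∸ k))
              choose (inj₁ e) = inj₁ (Mid.k<i h , s≤s (m+n≤o⇒m≤o∸n i e))
              choose (inj₂ (inj₁ e)) = inj₂ (Mid.i≤L h , Mid.l<L∸i h , s≤s (m+n≤o⇒m≤o∸n (L ∸ i) e))
              choose (inj₂ (inj₂ e)) = ⊥-elim (wide e)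

        Fibre : (Fin n → Set) → (Fin n → ℕ) → ℕ → Set
        Fibre P g i = Σ (Fin n) λ v → P v × g v ≡ i

        -- Before k and after L - l the reason for not being a start is recorded. In between, an
        -- extra vertex belongs to `Rest` and may spoil two indices, one from each end.
        Cover : ℕ → Set
        Cover i = i ≤ ρ ⊎ ((i ≤ L × L ∸ i ≤ ρ) ⊎ ((i ≤ L × Missing (u i)) ⊎
          (Fibre Left f i ⊎ ((i ≤ L × Fibre Right f′ (L ∸ i)) ⊎ (Fibre Rest f i ⊎ ((i ≤ L × Fibre Rest f′ (L ∸ i)) ⊎
          (i ≡ k ⊎ (i ≡ L ∸ l ⊎ Mid i))))))))

        cover : ∀ i → i < suc L → Cover i
        cover i (s≤s i≤L) with <-cmp i k
        ... | tri< i<k _ _ with before-k i i<k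
        ...   | inj₁ h = inj₁ h
        ...   | inj₂ (inj₁ h) = inj₂ (inj₂ (inj₁ h))
        ...   | inj₂ (inj₂ (v , ex , e)) = inj₂ (inj₂ (inj₂ (inj₁ (v , (ex , subst (_< k) (≡-sym e) i<k) , e))))
        cover i (s≤s i≤L) | tri≈ _ e _ = inj₂ (inj₂ (inj₂ (inj₂ (inj₂ (inj₂ (inj₂ (inj₁ e)))))))
        cover i (s≤s i≤L) | tri> _ _ k<i with <-cmp (L ∸ i) l
        ... | tri< j<l _ _ with before-l (L ∸ i) j<l
        ...   | inj₁ h = inj₂ (inj₁ (i≤L , h))
        ...   | inj₂ (inj₁ (_ , h)) = inj₂ (inj₂ (inj₁ (i≤L , λ j e → h j (trans (cong u (reflect i≤L)) e))))
        ...   | inj₂ (inj₂ (v , ex , e)) = inj₂ (inj₂ (inj₂ (inj₂ (inj₁ (i≤L , v , (unflip ex , subst (_< l) (≡-sym e) j<l) , e)))))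
        cover i (s≤s i≤L) | tri> _ _ k<i | tri≈ _ e _ =
          inj₂ (inj₂ (inj₂ (inj₂ (inj₂ (inj₂ (inj₂ (inj₂ (inj₁ (trans (≡-sym (reflect i≤L)) (cong (L ∸_) e))))))))))
        cover i (s≤s i≤L) | tri> _ _ k<i | tri> _ _ l<j with listed (u i) | S.single i i≤L | S′.single (L ∸ i) (m∸n≤m L i)
        ... | inj₂ h | _ | _ = inj₂ (inj₂ (inj₁ (i≤L , h)))
        -- Here f v = i > k and f′ v ≥ L - i > l, so v is in `Rest`.
        ... | inj₁ _ | inj₂ (v , ex , e) | _ = inj₂ (inj₂ (inj₂ (inj₂ (inj₂ (inj₁
          (v , (ex , <⇒≯ (subst (k <_) (≡-sym e) k<i) , λ lt → <⇒≱ (<-trans lt l<j) (m≤n+o⇒m∸n≤o L i (subst (λ t → L ≤ t + f′ v) e (S.f+f′ v)))) , e))))))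
        ... | inj₁ _ | inj₁ _ | inj₂ (v , ex , e) = inj₂ (inj₂ (inj₂ (inj₂ (inj₂ (inj₂ (inj₁ (i≤L ,
          v , (unflip ex , (λ lt → <⇒≱ (<-trans lt k<i) (back v e)) , <⇒≯ (subst (l <_) (≡-sym e) l<j)) , e)))))))
          where
          back : ∀ v → f′ v ≡ L ∸ i → i ≤ f v
          back v e = +-cancelʳ-≤ (L ∸ i) i (f v) (≤-trans (≤-reflexive (m+[n∸m]≡n i≤L)) (subst (λ t → L ≤ f v + t) e (S.f+f′ v)))
        ... | inj₁ j | inj₁ h | inj₁ h′ = inj₂ (inj₂ (inj₂ (inj₂ (inj₂ (inj₂ (inj₂ (inj₂ (inj₂
          (record { k<i = k<i ; i≤L = i≤L ; l<L∸i = l<j ; single = h ; single′ = h′ ; label = j })))))))))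

        atMost-Cover : AtMost (a + b) Mid → AtMost (suc ρ + (suc ρ + (μ + (a + (b + (c + (c + (1 + (1 + (a + b))))))))))  Cover
        atMost-Cover mid = atMost-⊎ (atMost-initial ρ) (atMost-⊎ (atMost-reflect (atMost-initial ρ))
          (atMost-⊎ (atMost-missing s (λ i → i) (λ e → e)) (atMost-⊎ (atMost-fibre f (atMost (proj₂ left)))
          (atMost-⊎ (atMost-reflect (atMost-fibre f′ (atMost (proj₂ right)))) (atMost-⊎ (atMost-fibre f (atMost (proj₂ rest)))
          (atMost-⊎ (atMost-reflect (atMost-fibre f′ (atMost (proj₂ rest)))) (atMost-⊎ (atMost-≡ k) (atMost-⊎ (atMost-≡ (L ∸ l)) mid))))))))

      impossible : ∀ {d} → Walk G (_≢ x) z₁ z₂ d → d < L → ⊥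
      -- With `Mid` charged to `Left` and `Right`, each extra vertex counts twice, so L + 1 ≤ 4ρ + μ
      -- + 4 ≤ 5μ + 4.
      impossible walk d<L = 1+n≰n (linear {b = 0} 6 (atMost-upTo (atMost-Cover (few-mid (passage walk) d<L)) cover ⊕ big ⊕ 2 ⊙ a+b+c≤ρ ⊕ 4 ⊙ ρ≤μ) (arith L ρ μ a b c))
        where
        arith : ∀ L ρ μ a b c → suc L + (5 * μ + 10 + (2 * (a + (b + c)) + 4 * ρ)) + 0 ≡
          suc ρ + (suc ρ + (μ + (a + (b + (c + (c + (1 + (1 + (a + b))))))))) + (L + (2 * ρ + 4 * μ)) + 1 + 6
        arith = solve-∀

    module _ {k l : ℕ} (k+l≤L : k + l ≤ L) (start-k : T.Start k) (start-l : T′.Start l)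
      (before-k : ∀ t → t < k → T.NotStart t) (before-l : ∀ t → t < l → T′.NotStart t) where

      private
        k≤L : k ≤ L
        k≤L = ≤-trans (m≤m+n k l) k+l≤L
        l≤L : l ≤ L
        l≤L = ≤-trans (m≤n+m l k) k+l≤L
        ρ<k = proj₁ start-k
        ρ<l = proj₁ start-l

        dist-at : ∀ {i} → (Σ (Fin m) λ j → u i ≡ X j) → Σ _ λ a → Σ _ λ b → Dist G (_≢ u i) a b L
        dist-at (j , e) = subst (λ v → Σ _ λ a → Σ _ λ b → Dist G (_≢ v) a b L) (≡-sym e) (geodesic j)

      -- The distance of z₁ and z₂ in G - x is at most L by `no-long-detour` and differs from L by
      -- parity, which leaves the case of `impossible`.
      separated : (Σ (Fin n) λ z → Adj G x z × A.Low k z) → (Σ (Fin n) λ z → Adj G x z × B.Low l z) → ⊥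
      separated (z₁ , xz₁ , low₁) (z₂ , xz₂ , low₂) = close (walk-dist (≢-dec x) connected)
        where
        z₁≢z₂ : z₁ ≢ z₂
        z₁≢z₂ refl = <⇒≱ (+-mono-< (proj₂ low₁) (proj₂ low₂)) (≤-trans k+l≤L (S.f+f′ z₁))
        neighbours : ∀ v → Adj G x v → v ≡ z₁ ⊎ v ≡ z₂
        neighbours = two-neighbours {G = G} (proj₂ (proj₂ low-degree-x)) xz₁ xz₂ z₁≢z₂
        -- From z₁ down to u 0, across to u L, and from there to z₂.
        connected : Walk G (_≢ x) z₁ z₂ (f z₁ + (f (u L) + f′ z₂))
        connected = walk-++ (walk-rev (walk-⊆ (λ _ → proj₁) (A.root-walk k≤L low₁)))
          (walk-++ (walk-⊆ (λ _ → proj₁) (S.f-walk (u L) (≤-reflexive (S.f-u L ≤-refl))))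
            (walk-⊆ (λ _ → proj₁) (B.root-walk l≤L low₂)))
        close : ∀ {d₀} → (Σ ℕ λ d → Dist G (_≢ x) z₁ z₂ d × d ≤ d₀) → ⊥
        close (d , D , _) = impossible k+l≤L k≤L l≤L ρ<k ρ<l (proj₁ (proj₂ start-k)) (proj₁ (proj₂ start-l)) before-k before-l
          neighbours xz₁ xz₂ low₁ low₂ (proj₁ D)
          (≤∧≢⇒< (Detours.no-long-detour X X-injective μ+m≡n G ρ+L≡n ρ≤μ big few-far neighbours xz₁ xz₂ D) d≢L)
          where
          d≢L : d ≢ L
          d≢L refl with trans (≡-sym odd-L) (even-walk bipartite xz₁ xz₂ (proj₁ D))
          ... | ()

      no-starts : ⊥
      no-starts = separated
        (A.side-neighbour ρ+L≡n ρ<k (≤-trans (+-monoʳ-≤ k (<⇒≤ ρ<l)) k+l≤L) (proj₁ (proj₂ start-k))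
          (proj₂ (proj₂ (dist-at (proj₂ (proj₂ start-k))))))
        (B.side-neighbour ρ+L≡n ρ<l (≤-trans (≤-trans (+-monoʳ-≤ l (<⇒≤ ρ<k)) (≤-reflexive (+-comm l k))) k+l≤L) (proj₁ (proj₂ start-l))
          (proj₂ (proj₂ (dist-at (proj₂ (proj₂ start-l))))))

    not-low-degree : ⊥
    not-low-degree = go doubly
      where
      go : (Σ ℕ λ i → i ≤ L × T.Start i × T′.Start (L ∸ i)) → ⊥
      go (i , i≤L , h , h′) = conclude (T.earliest i≤L h) (T′.earliest (m∸n≤m L i) h′)
        where
        conclude : (Σ ℕ λ k → k ≤ i × T.Start k × (∀ t → t < k → T.NotStart t)) →
          (Σ ℕ λ l → l ≤ L ∸ i × T′.Start l × (∀ t → t < l → T′.NotStart t)) → ⊥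
        conclude (k , k≤i , start-k , before-k) (l , l≤j , start-l , before-l) =
          no-starts (≤-trans (+-mono-≤ k≤i l≤j) (≤-reflexive (m+[n∸m]≡n i≤L))) start-k start-l before-k before-l

-- Odd closed walks and the proof of the theorem

bipartite-if-no-odd-walk : ∀ {n} {H : Graph n} {y col} → ProperOff H y col →
  (∀ q → ¬ Walk H Everywhere y y (suc (q + q))) → Bipartite H
bipartite-if-no-odd-walk {n} {H} {y} {col} proper none = (λ v → colour v (lev v <? n)) , λ v w e → check e (lev v <? n) (lev w <? n)
  where
  open Level (level H {Everywhere} (λ _ → yes _) y n)
  colour : ∀ v → Dec (lev v < n) → Bool
  -- The component of y is coloured by the parity of the distance from y; all other vertices differ
  -- from y and keep their colour from H - y.
  colour v (yes _) = parity (lev v)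
  colour v (no _)  = col v
  reached : ∀ {v k} → Walk H Everywhere y v k → lev v < n
  reached p = ≤-<-trans (lev-min (proj₁ (proj₂ short))) (proj₂ (proj₂ short))
    where short = walk-bounded (λ _ → yes _) atMost-Fin p
  unreached-≢ : ∀ {v} → ¬ (lev v < n) → v ≢ y
  unreached-≢ ≮n refl = ≮n (reached (nil _))
  check : ∀ {v w} → Adj H v w → (d : Dec (lev v < n)) (d′ : Dec (lev w < n)) → colour v d ≢ colour w d′
  -- Levels of equal parity at the ends of an edge would give a closed walk at y of odd length lev v
  -- + 1 + lev w.
  check {v} {w} e (yes p) (yes q) same with odd-form (suc (lev v + lev w)) (cong not (trans (parity-+ (lev v) (lev w))
    (trans (cong (_xor parity (lev w)) same) (Bool.xor-same (parity (lev w))))))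
  ... | t , eq = none t (subst (Walk H Everywhere y y) (trans (+-suc (lev v) (lev w)) eq)
    (walk-++ (lev-walk v p) (cons _ e (walk-rev (lev-walk w q)))))
  check e (yes p) (no ≮n) _ = ≮n (reached (walk-snoc (lev-walk _ p) e _))
  check e (no ≮n) (yes q) _ = ≮n (reached (walk-snoc (lev-walk _ q) (adj-sym H e) _))
  check e (no p) (no q) same = proper (unreached-≢ p) (unreached-≢ q) e same

theorem4 : (k : ℕ) → 3 ≤ suc k → (G H : Graph (suc k)) →
    Bipartite G → ¬ Bipartite H →
    ∀ m → HasCommonCards G H m → 6 * m < 5 * suc k + 12
theorem4 k _ G H bip ¬bip m (x , y , x-injective , y-injective , cards) = ≰⇒> (many m x y x-injective y-injective cards)
  where
  n : ℕ
  n = suc k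
  many : ∀ m (x y : Fin m → Fin n) → (∀ {i j} → x i ≡ x j → i ≡ j) → (∀ {i j} → y i ≡ y j → i ≡ j) →
    (∀ j → card G (x j) ≅ card H (y j)) → ¬ (5 * n + 12 ≤ 6 * m)
  -- For m ≤ 1 the inequality fails since 6m < 12; beyond that there are two matched vertices, as
  -- `low-degree` asks.
  many zero _ _ _ _ _ h = <⇒≱ z<s (≤-trans (m≤n+m 12 (5 * n)) h)
  many (suc zero) _ _ _ _ _ h = <⇒≱ (m≤m+n 7 5) (≤-trans (m≤n+m 12 (5 * n)) h)
  many m@(suc (suc _)) x y x-injective y-injective cards h =
    -- No odd closed walk is extracted from non-bipartiteness; instead each one is refuted, after
    -- passing to a shortest one, which makes H bipartite.
    ¬bip (bipartite-if-no-odd-walk (proj₂ (colouring Fin.zero)) λ q W →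
      minimal q (least {OddAt} (λ q → F.any? λ v → walk? (λ _ → yes _) v v (suc (q + q))) {q} (y Fin.zero , W)))
    where
    iso : ∀ j → OffIso G (x j) H (y j)
    iso j = card-offIso (cards j)
    colouring : ∀ j → Σ _ (ProperOff H (y j))
    colouring j = proper-to (iso j) bip

    OddAt : ℕ → Set
    OddAt q = Σ (Fin n) λ v → Walk H Everywhere v v (suc (q + q))

    minimal : ∀ q₀ → (Σ ℕ λ q → OddAt q × q ≤ q₀ × (∀ t → OddAt t → q ≤ t)) → ⊥
    -- A closed walk of length 1 would be a loop.
    minimal _ (zero , (v , cons _ e (nil _)) , _) = adj-irrefl H e
    minimal _ (suc r , (v , W) , _ , min) = Contradiction.not-low-degree x x-injective μ+m≡n G ρ+ℓ≡n ρ≤μ big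
        few-far geodesic bip parity-L (spine (proj₂ (proj₂ (geodesic (proj₁ low))))) (proj₂ low)
      where
      open ShortestOddCycle H r W (λ q v p → min q (v , p))
      μ ρ : ℕ
      μ = n ∸ m
      ρ = n ∸ ℓ
      m≤n : m ≤ n
      m≤n = F.injective⇒≤ x-injective
      μ+m≡n : μ + m ≡ n
      μ+m≡n = m∸n+n≡m m≤n
      ρ+ℓ≡n : ρ + ℓ ≡ n
      ρ+ℓ≡n = m∸n+n≡m ℓ≤n
      onC-y : ∀ j → OnC (y j)
      onC-y j = transversal (proj₂ (colouring j))
      m≤ℓ : m ≤ ℓ
      m≤ℓ = F.injective⇒≤ {f = λ j → fromℕ< (proj₁ (proj₂ (onC-y j)))} λ {i} {j} e →
        y-injective (trans (proj₂ (proj₂ (onC-y i))) (trans (cong c (F.fromℕ<-injective _ _ _ _ e)) (≡-sym (proj₂ (proj₂ (onC-y j))))))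
      ρ≤μ : ρ ≤ μ
      ρ≤μ = ∸-monoʳ-≤ n m≤ℓ
      -- From 6m ≥ 5n + 12 and n = μ + m follows m ≥ 5μ + 12, and L + 2 = ℓ ≥ m.
      big : 5 * μ + 10 ≤ L
      big = linear 0 (h ⊕ m≤ℓ ⊕ 5 ⊙ ≤-reflexive μ+m≡n) (arith n m μ L)
        where
        arith : ∀ n m μ L → 5 * n + 12 + (m + 5 * (μ + m)) + L ≡ 6 * m + (suc (suc L) + 5 * n) + (5 * μ + 10) + 0
        arith = solve-∀
      ρ<ℓ : ρ < ℓ
      ρ<ℓ = linear (4 * μ + 11) (big ⊕ ρ≤μ) (arith ρ μ L)
        where
        arith : ∀ ρ μ L → 5 * μ + 10 + ρ + suc (suc L) ≡ L + μ + suc ρ + (4 * μ + 11)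
        arith = solve-∀
      -- The card isomorphism carries a distance above L from G - x j to H - y j, where it forces a
      -- mark on y j; and y j determines x j.
      few-far : AtMost (ρ + (ρ + ρ)) (λ v → Σ (Fin m) λ j → v ≡ x j × Far G v (suc L))
      few-far = atMost-image (λ v w → Σ (Fin m) λ j → v ≡ x j × w ≡ y j)
        (λ { (j , refl , e) (j′ , refl , e′) → cong x (y-injective (trans (≡-sym e) e′)) })
        (λ { v (j , refl , far) → y j , far⇒marked ρ+ℓ≡n ρ<ℓ (onC-y j) (far-to (iso j) far) , j , refl , refl })
        (atMost-Marked ρ+ℓ≡n)
      geodesic : ∀ j → Σ _ λ a → Σ _ λ b → Dist G (_≢ x j) a b L
      geodesic j with rim (proj₂ (colouring j))
      ... | _ , _ , D = _ , _ , dist-to (offIso-sym (iso j)) D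
      low : Σ (Fin m) λ j → Cards.LowDegree x x-injective μ+m≡n G (x j)
      low = Cards.low-degree x x-injective μ+m≡n G ρ+ℓ≡n ρ≤μ big geodesic
        {Fin.zero} {Fin.suc Fin.zero} (λ e → F.0≢1+n (x-injective e))
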